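{- Let $n\ge2$. The $h$-polynomial of the bipermutahedral fan $\Sigma_{n,n}$ equals the $n$th biEulerian polynomial $B_n(x)=\sum_{i=0}^{2n-2}b(n,i)x^i$; that is, $h_i(\Sigma_{n,n})=b(n,i)$ for $0\le i\le 2n-2$, where $b(n,i)$ is the number of bipermutations of $[n]$ with exactly $i$ descents.
   Context: Let $N_n=\mathbb{R}^n/\mathbb{R}(1,\dots,1)$; for $S\subseteq[n]$ let $\mathsf{e}_S$, $\mathsf{f}_S$ be the images in the first, second factor of $N_n\times N_n$ of the indicator vector of $S$. A bipermutation of $[n]$ is a sequence $\mathsf{B}=b_1|\cdots|b_{2n-1}$ of elements of $[n]$ in which one element $k=k(\mathsf{B})$ appears exactly once and every other element exactly twice. The bipermutahedral fan $\Sigma_{n,n}$ is the complete simplicial fan in $N_n\times N_n$ (dimension $2n-2$) whose maximal cones are $\mathrm{cone}\{\mathsf{e}_{\{b_1,\dots,b_m\}}+\mathsf{f}_{\{b_{m+1},\dots,b_{2n-1}\}}:1\le m\le 2n-2\}$ for the bipermutations $\mathsf{B}$, together with all their faces. For a $D$-dimensional simplicial fan with $f_i$ cones of dimension $i$, its $h$-vector $(h_0,\dots,h_D)$ is defined by $\sum_{i=0}^D h_i(x+1)^{D-i}=\sum_{i=0}^D f_ix^{D-i}$, and its $h$-polynomial is $\sum_i h_ix^i$. Descents: write $\mathsf{B}$ with first occurrences of each $i\ne k$ as $i$ and second occurrences as $\overline i$; the single occurrence of $k$ is regarded as $k$ when compared with an unbarred letter and as $\overline k$ when compared with a barred letter.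 Two consecutive letters $i|j$ form a descent if (a) both are unbarred and $i>j$; or (b) both are barred and $i<j$; or (c) $i$ is an unbarred element of $[n]\setminus\{k\}$, $j$ is a barred element $\overline{j'}$ with $j'\ne k$, and $i>k$; or (d) $i$ is barred with $i\ne\overline k$, $j$ is an unbarred element of $[n]\setminus\{k\}$, and $j<k$. (Here comparisons of barred letters $\overline a,\overline b$ compare $a,b$.) -}

module Defs where

open import Data.Nat as ℕ using (ℕ; zero; suc; _+_; _∸_; _<ᵇ_; _≡ᵇ_)
open import Data.Integer as ℤ using (ℤ; +_)
open import Data.Fin as Fin using (Fin; toℕ)
open import Data.Bool using (Bool; true; false; _∧_; _∨_; not; if_then_else_)
open import Data.List using (List; []; _∷_; _++_; map; concatMap; foldr; length; take; drop; upTo; allFin; deduplicateᵇ)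
open import Data.Bool.ListAction using (all; any)
open import Data.Product using (_×_; _,_)
open import Relation.Nullary.Decidable using (Dec; does)
open import Relation.Binary.PropositionalEquality using (_≡_)
import Data.List.Properties as LP
import Data.Product.Properties as PP

countᵇ : {A : Set} → (A → Bool) → List A → ℕ
countᵇ p [] = 0
countᵇ p (x ∷ xs) = (if p x then 1 else 0) + countᵇ p xs

allSeqs : (n m : ℕ) → List (List (Fin n))
allSeqs n zero = [] ∷ []
allSeqs n (suc m) = concatMap (λ xs → map (_∷ xs) (allFin n)) (allSeqs n m)

_==_ : {n : ℕ} → Fin n → Fin n → Bool
i == j = does (i Fin.≟ j)

occ : {n : ℕ} → Fin n → List (Fin n) → ℕ
occ i B = countᵇ (λ j → i == j) B

isBipermWith : (n : ℕ) → Fin n → List (Fin n) → Bool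
isBipermWith n k B =
  (occ k B ≡ᵇ 1) ∧ all (λ j → (j == k) ∨ (occ j B ≡ᵇ 2)) (allFin n)

isBiperm : (n : ℕ) → List (Fin n) → Bool
isBiperm n B = any (λ k → isBipermWith n k B) (allFin n)

bipermutations : (n : ℕ) → List (List (Fin n))
bipermutations n = Data.List.filterᵇ (isBiperm n) (allSeqs n (2 ℕ.* n ∸ 1))
  where import Data.List

-- letters: unbarred i, barred i, or the single occurrence of k
data Letter (n : ℕ) : Set where
  unb : Fin n → Letter n
  bar : Fin n → Letter n
  kk  : Letter n

mark : {n : ℕ} → Fin n → List (Fin n) → List (Fin n) → List (Letter n)
mark k seen [] = []
mark k seen (x ∷ xs) =
  (if x == k then kk else (if any (λ y → y == x) seen then bar x else unb x))
    ∷ mark k (x ∷ seen) xs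

_<F_ : {n : ℕ} → Fin n → Fin n → Bool
i <F j = toℕ i <ᵇ toℕ j

isDesc : {n : ℕ} → Fin n → Letter n → Letter n → Bool
isDesc k (unb i) (unb j) = j <F i
isDesc k (bar i) (bar j) = i <F j
isDesc k (unb i) (bar j) = k <F i
isDesc k (bar i) (unb j) = j <F k
isDesc k (unb i) kk      = k <F i
isDesc k kk      (unb j) = j <F k
isDesc k (bar i) kk      = i <F k
isDesc k kk      (bar j) = k <F j
isDesc k kk      kk      = false

descLetters : {n : ℕ} → Fin n → List (Letter n) → ℕ
descLetters k (x ∷ y ∷ r) = (if isDesc k x y then 1 else 0) + descLetters k (y ∷ r)
descLetters k _ = 0

descents : {n : ℕ} → Fin n → List (Fin n) → ℕ
descents k B = descLetters k (mark k [] B)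

-- b(n,i): number of bipermutations of [n] with exactly i descents
-- (each bipermutation B is counted once, with k = k(B), which is unique)
bnum : ℕ → ℕ → ℕ
bnum n i = countᵇ (λ B → any (λ k → isBipermWith n k B ∧ (descents k B ≡ᵇ i)) (allFin n))
                  (bipermutations n)

-- an element of N_n = ℤ^n / ℤ(1,…,1) is represented canonically by the
-- representative whose last coordinate is 0
lastℤ : List ℤ → ℤ
lastℤ [] = + 0
lastℤ (x ∷ []) = x
lastℤ (x ∷ y ∷ r) = lastℤ (y ∷ r)

canon : List ℤ → List ℤ
canon v = map (λ a → a ℤ.- lastℤ v) v

indicator : (n : ℕ) → List (Fin n) → List ℤ
indicator n S = map (λ j → if any (λ s → s == j) S then + 1 else + 0) (allFin n)

-- points of N_n × N_n, in canonical form
Pt : Set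
Pt = List ℤ × List ℤ

_≟Pt_ : (p q : Pt) → Dec (p ≡ q)
_≟Pt_ = PP.≡-dec (LP.≡-dec ℤ._≟_) (LP.≡-dec ℤ._≟_)

ray : (n : ℕ) → List (Fin n) → List (Fin n) → Pt
ray n S T = canon (indicator n S) , canon (indicator n T)

maxGens : (n : ℕ) → List (Fin n) → List Pt
maxGens n B = map (λ t → ray n (take (suc t) B) (drop (suc t) B)) (upTo (2 ℕ.* n ∸ 2))

-- all sub-collections of a list (faces of a simplicial cone)
sublists : {A : Set} → List A → List (List A)
sublists [] = [] ∷ []
sublists (x ∷ xs) = sublists xs ++ map (x ∷_) (sublists xs)

-- two cones are equal iff they have the same set of rays
sameSet : List Pt → List Pt → Bool
sameSet xs ys = all (λ x → any (λ y → does (x ≟Pt y)) ys) xs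
              ∧ all (λ y → any (λ x → does (x ≟Pt y)) xs) ys

-- all cones of Σ_{n,n}: the maximal cones and all their faces, without repetition,
-- each given by its set of rays
cones : (n : ℕ) → List (List Pt)
cones n = deduplicateᵇ sameSet (concatMap (λ B → sublists (maxGens n B)) (bipermutations n))

-- f_i(Σ_{n,n}): number of cones of dimension i (= number of rays, fan is simplicial)
fvec : ℕ → ℕ → ℕ
fvec n i = countᵇ (λ c → length c ≡ᵇ i) (cones n)

-- Polynomials over ℤ as coefficient lists (constant term first)

Poly : Set
Poly = List ℤ

_⊕_ : Poly → Poly → Poly
[] ⊕ q = q
(a ∷ p) ⊕ [] = a ∷ p
(a ∷ p) ⊕ (b ∷ q) = (a ℤ.+ b) ∷ (p ⊕ q)

scale : ℤ → Poly → Poly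
scale a p = map (a ℤ.*_) p

_⊗_ : Poly → Poly → Poly
[] ⊗ q = []
(a ∷ p) ⊗ q = scale a q ⊕ (+ 0 ∷ (p ⊗ q))

pow : Poly → ℕ → Poly
pow p zero = + 1 ∷ []
pow p (suc k) = p ⊗ pow p k

Xp : Poly
Xp = + 0 ∷ + 1 ∷ []

X+1 : Poly
X+1 = + 1 ∷ + 1 ∷ []

coeff : Poly → ℕ → ℤ
coeff [] j = + 0
coeff (a ∷ p) zero = a
coeff (a ∷ p) (suc j) = coeff p j

sumPow : ℕ → (ℕ → ℤ) → Poly → Poly
sumPow D c q = foldr _⊕_ [] (map (λ i → scale (c i) (pow q (D ∸ i))) (upTo (suc D)))

IsHVector : ℕ → (ℕ → ℤ) → (ℕ → ℤ) → Set
IsHVector D f h = ∀ j → coeff (sumPow D h X+1) j ≡ coeff (sumPow D f Xp) j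

{-# OPTIONS --safe #-}
module Submission where

open import Defs
open import Data.Bool using (Bool; true; false; T; not; if_then_else_; _∧_; _∨_)
open import Data.Bool.ListAction using (all; any)
open import Data.Bool.Properties using (T?; T-≡; T-∧)
open import Data.Empty using (⊥; ⊥-elim)
open import Data.Fin as Fin using (Fin; zero; suc; toℕ)
import Data.Fin.Properties as Finₚ
open import Data.Integer as ℤ using (ℤ; +_)
import Data.Integer.Properties as ℤₚ
open import Data.List
  using (List; []; _∷_; _++_; allFin; applyUpTo; concatMap; deduplicateᵇ; drop; filter; foldr; length; map; take; upTo)
import Data.List.Properties as Listₚ
open import Data.List.Membership.Propositional using (_∈_; _∉_)
open import Data.List.Membership.Propositional.Properties
open import Data.List.Membership.Propositional.Properties.WithK using (unique∧set⇒bag)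
open import Data.List.Relation.Binary.BagAndSetEquality using (∼bag⇒↭)
open import Data.List.Relation.Binary.Permutation.Propositional as Perm using (_↭_)
import Data.List.Relation.Binary.Permutation.Propositional.Properties as Permₚ
import Data.List.Relation.Binary.Permutation.Setoid.Properties as PermSetoidₚ
open import Data.List.Relation.Unary.All as All using (All; []; _∷_)
import Data.List.Relation.Unary.All.Properties as Allₚ
open import Data.List.Relation.Unary.AllPairs as AllPairs using (AllPairs; []; _∷_)
import Data.List.Relation.Unary.AllPairs.Properties as AllPairsₚ
open import Data.List.Relation.Unary.Any as Any using (here; there)
import Data.List.Relation.Unary.Any.Properties as Anyₚ
open import Data.List.Relation.Unary.Linked using (Linked; []; [-]; _∷_)
import Data.List.Relation.Unary.Linked.Properties as Linkedₚ
open import Data.List.Relation.Unary.Unique.Propositional using (Unique)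
import Data.List.Relation.Unary.Unique.Propositional.Properties as Uniqueₚ
import Data.List.Sort as Sort
open import Data.Nat as ℕ
  using (ℕ; zero; suc; _+_; _*_; _∸_; _≤_; _<_; _≤?_; _<?_; _≡ᵇ_; _<ᵇ_; z≤n; s≤s)
import Data.Nat.Properties as ℕₚ
open import Data.Product using (∃; ∃₂; _×_; _,_; proj₁; proj₂; map₁)
open import Data.Sum using (_⊎_; inj₁; inj₂)
open import Data.Unit using (⊤; tt)
open import Function using (_∘_; id)
open import Function.Bundles using (Equivalence; mk⇔)
import Relation.Binary.Construct.On as On
open import Relation.Binary.Definitions using (tri<; tri≈; tri>)
open import Relation.Binary.PropositionalEquality
  using (_≡_; _≢_; refl; sym; trans; cong; cong₂; subst; subst₂; setoid; module ≡-Reasoning)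
open import Relation.Nullary using (¬_; Dec; yes; no; ¬?)
open import Relation.Nullary.Decidable using (does; dec-true; dec-false)
open import Relation.Unary using (Decidable)

-- Cut a bipermutation into blocks and remember, for every letter, the index of its block.  The cone
-- spanned by the rays at the cuts determines and is determined by the set of pairs (element, block
-- index).  For fixed k the descents are the descents with respect to a linear order of the letters,
-- so each cone has exactly one presentation whose blocks are increasing: k must be the largest
-- element with a single block index, and the letters are sorted by block index and then by the
-- order belonging to k.  Hence cones of dimension m correspond to pairs of a bipermutation and a set
-- of m cuts containing its descents, which is the expansion of Σ hᵢ (x + 1)^(D − i) in powers of x.

-- The obstacle is that an element with both occurrences in one block leaves the same trace in a
-- cone as the single `k`. One cone therefore arises from bipermutations with different `k`, and the
-- notion of descent changes with `k`. In the order belonging to `k`, unbarred `j` precedes barred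
-- `j` when `j < k` and follows it when `j > k`. A first occurrence is always unbarred, so a sorted
-- block can hold both occurrences of `j` only if `j < k`. This forces `k` to be the largest
-- candidate, and makes that choice succeed. With `P j` and `Q j` the first and last block of `j`,
-- the ray at the cut after block `b` has `j` in its first support iff `P j ≤ b` and in its second
-- iff `b < Q j`; hence the rays determine `P` and `Q`. Modulo (1,...,1) the empty and the full
-- support coincide, so reading a support off a ray relies on both supports being nonempty. Cones
-- are compared as sets of rays. Along a cone the first supports grow and the second ones shrink, so
-- the set determines the list.

private
  variable
    A B : Set
    n : ℕ

-- Integer sums over lists and counting by value.

bool : Bool → ℤ
bool b = + (if b then 1 else 0)

Σℤ : (A → ℤ) → List A → ℤ
Σℤ f []       = + 0
Σℤ f (x ∷ xs) = f x ℤ.+ Σℤ f xs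

Σℤ-cong : {f g : A → ℤ} (xs : List A) → (∀ {x} → x ∈ xs → f x ≡ g x) → Σℤ f xs ≡ Σℤ g xs
Σℤ-cong []       h = refl
Σℤ-cong (x ∷ xs) h = cong₂ ℤ._+_ (h (here refl)) (Σℤ-cong xs (h ∘ there))

Σℤ-++ : (f : A → ℤ) (xs ys : List A) → Σℤ f (xs ++ ys) ≡ Σℤ f xs ℤ.+ Σℤ f ys
Σℤ-++ f []       ys = sym (ℤₚ.+-identityˡ _)
Σℤ-++ f (x ∷ xs) ys =
  trans (cong (λ z → f x ℤ.+ z) (Σℤ-++ f xs ys)) (sym (ℤₚ.+-assoc (f x) (Σℤ f xs) (Σℤ f ys)))

Σℤ-map : (f : B → ℤ) (g : A → B) (xs : List A) → Σℤ f (map g xs) ≡ Σℤ (f ∘ g) xs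
Σℤ-map f g []       = refl
Σℤ-map f g (x ∷ xs) = cong (λ z → f (g x) ℤ.+ z) (Σℤ-map f g xs)

Σℤ-concatMap : (f : B → ℤ) (g : A → List B) (xs : List A) →
  Σℤ f (concatMap g xs) ≡ Σℤ (λ x → Σℤ f (g x)) xs
Σℤ-concatMap f g []       = refl
Σℤ-concatMap f g (x ∷ xs) =
  trans (Σℤ-++ f (g x) (concatMap g xs)) (cong (λ z → Σℤ f (g x) ℤ.+ z) (Σℤ-concatMap f g xs))

+-swapˡ : ∀ a b c → a ℤ.+ (b ℤ.+ c) ≡ b ℤ.+ (a ℤ.+ c)
+-swapˡ a b c = trans (sym (ℤₚ.+-assoc a b c))
  (trans (cong (ℤ._+ c) (ℤₚ.+-comm a b)) (ℤₚ.+-assoc b a c))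

Σℤ-↭ : (f : A → ℤ) {xs ys : List A} → xs ↭ ys → Σℤ f xs ≡ Σℤ f ys
Σℤ-↭ f Perm.refl         = refl
Σℤ-↭ f (Perm.prep x p)   = cong (λ z → f x ℤ.+ z) (Σℤ-↭ f p)
Σℤ-↭ f (Perm.swap x y p) =
  trans (cong (λ z → f x ℤ.+ (f y ℤ.+ z)) (Σℤ-↭ f p)) (+-swapˡ (f x) (f y) _)
Σℤ-↭ f (Perm.trans p q)  = trans (Σℤ-↭ f p) (Σℤ-↭ f q)

Σℤ-0 : {f : A → ℤ} (xs : List A) → (∀ {x} → x ∈ xs → f x ≡ + 0) → Σℤ f xs ≡ + 0
Σℤ-0 []       h = refl
Σℤ-0 (x ∷ xs) h = cong₂ ℤ._+_ (h (here refl)) (Σℤ-0 xs (h ∘ there))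

Σℤ-+ : (f g : A → ℤ) (xs : List A) → Σℤ (λ x → f x ℤ.+ g x) xs ≡ Σℤ f xs ℤ.+ Σℤ g xs
Σℤ-+ f g []       = refl
Σℤ-+ f g (x ∷ xs) = trans (cong (λ z → (f x ℤ.+ g x) ℤ.+ z) (Σℤ-+ f g xs))
  (trans (ℤₚ.+-assoc (f x) (g x) _)
  (trans (cong (λ z → f x ℤ.+ z) (+-swapˡ (g x) (Σℤ f xs) (Σℤ g xs)))
  (sym (ℤₚ.+-assoc (f x) (Σℤ f xs) _))))

Σℤ-single : {f : A → ℤ} {v : A} {xs : List A} → Unique xs → v ∈ xs →
  (∀ {x} → x ∈ xs → x ≢ v → f x ≡ + 0) → Σℤ f xs ≡ f v
Σℤ-single {f = f} (x∉ ∷ u) (here refl) h =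
  trans (cong (λ z → f _ ℤ.+ z)
          (Σℤ-0 _ λ {y} y∈ → h (there y∈) λ y≡ → All.lookup x∉ y∈ (sym y≡)))
        (ℤₚ.+-identityʳ _)
Σℤ-single {f = f} (x∉ ∷ u) (there v∈) h =
  trans (cong₂ ℤ._+_ (h (here refl) (All.lookup x∉ v∈)) (Σℤ-single u v∈ (h ∘ there)))
        (ℤₚ.+-identityˡ _)

countᵇ≡Σℤ : (p : A → Bool) (xs : List A) → + countᵇ p xs ≡ Σℤ (bool ∘ p) xs
countᵇ≡Σℤ p []       = refl
countᵇ≡Σℤ p (x ∷ xs) = cong (λ z → bool (p x) ℤ.+ z) (countᵇ≡Σℤ p xs)

countᵇ-cong : {p q : A → Bool} (xs : List A) → (∀ {x} → x ∈ xs → p x ≡ q x) →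
  countᵇ p xs ≡ countᵇ q xs
countᵇ-cong []       h = refl
countᵇ-cong (x ∷ xs) h =
  cong₂ (λ b m → (if b then 1 else 0) ℕ.+ m) (h (here refl)) (countᵇ-cong xs (h ∘ there))

≡ᵇ-refl : ∀ m → (m ≡ᵇ m) ≡ true
≡ᵇ-refl zero    = refl
≡ᵇ-refl (suc m) = ≡ᵇ-refl m

≡ᵇ-≢ : ∀ m {o} → m ≢ o → (m ≡ᵇ o) ≡ false
≡ᵇ-≢ zero    {zero}  h = ⊥-elim (h refl)
≡ᵇ-≢ zero    {suc o} h = refl
≡ᵇ-≢ (suc m) {zero}  h = refl
≡ᵇ-≢ (suc m) {suc o} h = ≡ᵇ-≢ m (h ∘ cong suc)

-- Both vectors pass through this regrouping: the `h` side with the number of descents as `g`, the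
-- `f` side with the number of rays. The bound on `g` keeps every value inside the summation range.
Σℤ-byValue : (D : ℕ) (φ : ℕ → ℤ) (g : A → ℕ) (xs : List A) → (∀ {x} → x ∈ xs → g x ≤ D) →
  Σℤ (λ i → + countᵇ (λ x → g x ≡ᵇ i) xs ℤ.* φ i) (upTo (suc D)) ≡ Σℤ (φ ∘ g) xs
Σℤ-byValue D φ g []       h = Σℤ-0 (upTo (suc D)) λ _ → refl
Σℤ-byValue D φ g (x ∷ xs) h = begin
  Σℤ (λ i → (bool (g x ≡ᵇ i) ℤ.+ + count i) ℤ.* φ i) (upTo (suc D))
    ≡⟨ Σℤ-cong (upTo (suc D)) (λ {i} _ → ℤₚ.*-distribʳ-+ (φ i) (bool (g x ≡ᵇ i)) (+ count i)) ⟩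
  Σℤ (λ i → bool (g x ≡ᵇ i) ℤ.* φ i ℤ.+ + count i ℤ.* φ i) (upTo (suc D))
    ≡⟨ Σℤ-+ (λ i → bool (g x ≡ᵇ i) ℤ.* φ i) _ (upTo (suc D)) ⟩
  Σℤ (λ i → bool (g x ≡ᵇ i) ℤ.* φ i) (upTo (suc D)) ℤ.+ Σℤ (λ i → + count i ℤ.* φ i) (upTo (suc D))
    ≡⟨ cong₂ ℤ._+_
         (trans (Σℤ-single (Uniqueₚ.upTo⁺ (suc D)) (∈-upTo⁺ (ℕ.s≤s (h (here refl))))
                  λ {i} _ i≢ → cong (λ b → bool b ℤ.* φ i) (≡ᵇ-≢ (g x) (i≢ ∘ sym)))
           (trans (cong (λ b → bool b ℤ.* φ (g x)) (≡ᵇ-refl (g x))) (ℤₚ.*-identityˡ _)))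
         (Σℤ-byValue D φ g xs (h ∘ there)) ⟩
  φ (g x) ℤ.+ Σℤ (φ ∘ g) xs ∎
  where
  open ≡-Reasoning
  count : ℕ → ℕ
  count i = countᵇ (λ x → g x ≡ᵇ i) xs

-- Coefficients of polynomials, and the expansion of powers of x + 1 over masks.

coeff-⊕ : ∀ p q j → coeff (p ⊕ q) j ≡ coeff p j ℤ.+ coeff q j
coeff-⊕ []      q       j       = sym (ℤₚ.+-identityˡ _)
coeff-⊕ (a ∷ p) []      j       = sym (ℤₚ.+-identityʳ _)
coeff-⊕ (a ∷ p) (b ∷ q) zero    = refl
coeff-⊕ (a ∷ p) (b ∷ q) (suc j) = coeff-⊕ p q j

coeff-scale : ∀ a p j → coeff (scale a p) j ≡ a ℤ.* coeff p j
coeff-scale a []      j       = sym (ℤₚ.*-zeroʳ a)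
coeff-scale a (b ∷ p) zero    = refl
coeff-scale a (b ∷ p) (suc j) = coeff-scale a p j

coeff-const⊗ : ∀ a q j → coeff ((a ∷ []) ⊗ q) j ≡ a ℤ.* coeff q j
coeff-const⊗ a q j = trans (coeff-⊕ (scale a q) _ j)
  (trans (cong₂ ℤ._+_ (coeff-scale a q j) (zeros j)) (ℤₚ.+-identityʳ _))
  where
  zeros : ∀ j → coeff (+ 0 ∷ []) j ≡ + 0
  zeros zero    = refl
  zeros (suc j) = refl

coeff-linear⊗-zero : ∀ a b q → coeff ((a ∷ b ∷ []) ⊗ q) 0 ≡ a ℤ.* coeff q 0
coeff-linear⊗-zero a b q = trans (coeff-⊕ (scale a q) _ 0)
  (trans (ℤₚ.+-identityʳ _) (coeff-scale a q 0))

coeff-linear⊗-suc : ∀ a b q j →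
  coeff ((a ∷ b ∷ []) ⊗ q) (suc j) ≡ a ℤ.* coeff q (suc j) ℤ.+ b ℤ.* coeff q j
coeff-linear⊗-suc a b q j = trans (coeff-⊕ (scale a q) _ (suc j))
  (cong₂ ℤ._+_ (coeff-scale a q (suc j)) (coeff-const⊗ b q j))

coeff-sumPow : ∀ D c q j →
  coeff (sumPow D c q) j ≡ Σℤ (λ i → c i ℤ.* coeff (pow q (D ∸ i)) j) (upTo (suc D))
coeff-sumPow D c q j = go (upTo (suc D))
  where
  term : ℕ → Poly
  term i = scale (c i) (pow q (D ∸ i))
  go : ∀ is → coeff (foldr _⊕_ [] (map term is)) j
            ≡ Σℤ (λ i → c i ℤ.* coeff (pow q (D ∸ i)) j) is
  go []       = refl
  go (i ∷ is) = trans (coeff-⊕ (term i) _ j)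
    (cong₂ ℤ._+_ (coeff-scale (c i) (pow q (D ∸ i)) j) (go is))

trues falses : List Bool → ℕ
trues  = countᵇ id
falses = countᵇ not

-- The sets of cuts that contain all descents `ds`: a descent forces a cut, any other place leaves
-- the choice free.
masksAbove : List Bool → List (List Bool)
masksAbove []           = [] ∷ []
masksAbove (true  ∷ ds) = map (true ∷_) (masksAbove ds)
masksAbove (false ∷ ds) = map (true ∷_) (masksAbove ds) ++ map (false ∷_) (masksAbove ds)

-- Each non-descent is cut or not, which expands (x + 1)^(number of non-descents).
coeff-pow-X+1 : ∀ ds j →
  Σℤ (λ μ → coeff (pow Xp (falses μ)) j) (masksAbove ds) ≡ coeff (pow X+1 (falses ds)) j
coeff-pow-X+1 []           j = ℤₚ.+-identityʳ _
coeff-pow-X+1 (true  ∷ ds) j =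
  trans (Σℤ-map _ (true ∷_) (masksAbove ds)) (coeff-pow-X+1 ds j)
coeff-pow-X+1 (false ∷ ds) j = begin
  Σℤ F (map (true ∷_) M ++ map (false ∷_) M)
    ≡⟨ Σℤ-++ F (map (true ∷_) M) _ ⟩
  Σℤ F (map (true ∷_) M) ℤ.+ Σℤ F (map (false ∷_) M)
    ≡⟨ cong₂ ℤ._+_ (trans (Σℤ-map F (true ∷_) M) (coeff-pow-X+1 ds j)) (Σℤ-map F (false ∷_) M) ⟩
  coeff P j ℤ.+ Σℤ (λ μ → coeff (Xp ⊗ pow Xp (falses μ)) j) M
    ≡⟨ shifted j ⟩
  coeff (X+1 ⊗ P) j ∎
  where
  open ≡-Reasoning
  F : List Bool → ℤ
  F μ = coeff (pow Xp (falses μ)) j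
  M = masksAbove ds
  P = pow X+1 (falses ds)
  shifted : ∀ j → coeff P j ℤ.+ Σℤ (λ μ → coeff (Xp ⊗ pow Xp (falses μ)) j) M ≡ coeff (X+1 ⊗ P) j
  shifted zero = trans
    (cong₂ ℤ._+_ (sym (ℤₚ.*-identityˡ (coeff P 0)))
      (Σℤ-0 M λ {μ} _ → coeff-linear⊗-zero (+ 0) (+ 1) (pow Xp (falses μ))))
    (trans (ℤₚ.+-identityʳ _) (sym (coeff-linear⊗-zero (+ 1) (+ 1) P)))
  shifted (suc j) = trans
    (cong₂ ℤ._+_ (sym (ℤₚ.*-identityˡ (coeff P (suc j))))
      (trans (Σℤ-cong M λ {μ} _ → trans (coeff-linear⊗-suc (+ 0) (+ 1) (pow Xp (falses μ)) j)
                                   (trans (ℤₚ.+-identityˡ _) (ℤₚ.*-identityˡ _)))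
        (trans (coeff-pow-X+1 ds j) (sym (ℤₚ.*-identityˡ _)))))
    (sym (coeff-linear⊗-suc (+ 1) (+ 1) P j))

-- Lists determined by their sets of elements.

unique∧set⇒↭ : {xs ys : List A} → Unique xs → Unique ys →
  (∀ {z} → z ∈ xs → z ∈ ys) → (∀ {z} → z ∈ ys → z ∈ xs) → xs ↭ ys
unique∧set⇒↭ u v f g = ∼bag⇒↭ (unique∧set⇒bag u v (mk⇔ f g))

-- If the heads differed, each would lie in the tail of the other list, giving both `R x y` and
-- `R y x`. It serves twice: for the rays of a cone and for labelled letters ordered by `key`.
sorted∧set⇒≡ : {R : A → A → Set} → (∀ {x y} → R x y → R y x → ⊥) →
  {xs ys : List A} → AllPairs R xs → AllPairs R ys →
  (∀ {z} → z ∈ xs → z ∈ ys) → (∀ {z} → z ∈ ys → z ∈ xs) → xs ≡ ys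
sorted∧set⇒≡ asym [] [] f g = refl
sorted∧set⇒≡ asym [] (_ ∷ _) f g with () ← g (here refl)
sorted∧set⇒≡ asym (_ ∷ _) [] f g with () ← f (here refl)
sorted∧set⇒≡ {R = R} asym {x ∷ xs} {y ∷ ys} (px ∷ pxs) (py ∷ pys) f g =
  cong₂ _∷_ x≡y (sorted∧set⇒≡ asym pxs pys f′ g′)
  where
  x≡y : x ≡ y
  x≡y with f (here refl) | g (here refl)
  ... | here eq  | _         = eq
  ... | there _  | here eq   = sym eq
  ... | there x∈ | there y∈ = ⊥-elim (asym (All.lookup px y∈) (All.lookup py x∈))
  f′ : ∀ {z} → z ∈ xs → z ∈ ys
  f′ z∈ with f (there z∈)
  ... | there z∈′ = z∈′
  ... | here refl with refl ← x≡y = let r = All.lookup px z∈ in ⊥-elim (asym r r)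
  g′ : ∀ {z} → z ∈ ys → z ∈ xs
  g′ z∈ with g (there z∈)
  ... | there z∈′ = z∈′
  ... | here refl with refl ← x≡y = let r = All.lookup py z∈ in ⊥-elim (asym r r)

allPairs-map∈ : {R S : A → A → Set} {xs : List A} →
  (∀ {x y} → x ∈ xs → y ∈ xs → R x y → S x y) → AllPairs R xs → AllPairs S xs
allPairs-map∈ f []       = []
allPairs-map∈ f (p ∷ ps) =
  All.tabulate (λ y∈ → f (here refl) (there y∈) (All.lookup p y∈))
    ∷ allPairs-map∈ (λ x∈ y∈ → f (there x∈) (there y∈)) ps

allPairs-lookup : {R : A → A → Set} {xs : List A} → AllPairs R xs →
  ∀ {x y} → x ∈ xs → y ∈ xs → x ≡ y ⊎ R x y ⊎ R y x
allPairs-lookup (p ∷ ps) (here refl) (here refl) = inj₁ refl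
allPairs-lookup (p ∷ ps) (here refl) (there y∈)  = inj₂ (inj₁ (All.lookup p y∈))
allPairs-lookup (p ∷ ps) (there x∈)  (here refl) = inj₂ (inj₂ (All.lookup p x∈))
allPairs-lookup (p ∷ ps) (there x∈)  (there y∈)  = allPairs-lookup ps x∈ y∈

map-unique : {f : A → B} {xs : List A} →
  (∀ {x y} → x ∈ xs → y ∈ xs → f x ≡ f y → x ≡ y) → Unique xs → Unique (map f xs)
map-unique inj u = AllPairsₚ.map⁺ (allPairs-map∈ (λ x∈ y∈ x≢y eq → x≢y (inj x∈ y∈ eq)) u)

-- `g` recovers from an element the `x` whose piece contains it, so pieces of different `x` are
-- disjoint.
concatMap-unique : {f : A → List B} (g : B → A) {xs : List A} → Unique xs →
  (∀ {x} → x ∈ xs → Unique (f x)) → (∀ {x y} → x ∈ xs → y ∈ f x → g y ≡ x) → Unique (concatMap f xs)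
concatMap-unique g u uf inv = Uniqueₚ.concat⁺
  (Allₚ.map⁺ (All.tabulate uf))
  (AllPairsₚ.map⁺ (allPairs-map∈
    (λ x∈ y∈ x≢y (z∈x , z∈y) → x≢y (trans (sym (inv x∈ z∈x)) (inv y∈ z∈y))) u))

module _ {r : A → A → Bool} where

  deduplicateᵇ-⊆ : ∀ {L z} → z ∈ deduplicateᵇ r L → z ∈ L
  deduplicateᵇ-⊆ {L} = ∈-deduplicate⁻ (λ x y → T? (r x y)) L

  deduplicateᵇ-unique : (∀ x → T (r x x)) → ∀ L → Unique (deduplicateᵇ r L)
  deduplicateᵇ-unique rr []      = []
  deduplicateᵇ-unique rr (x ∷ L) =
    All.map (λ ¬r eq → ¬r (subst (T ∘ r x) eq (rr x))) (Allₚ.all-filter (¬? ∘ λ y → T? (r x y)) (deduplicateᵇ r L))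
      ∷ AllPairsₚ.filter⁺ _ (deduplicateᵇ-unique rr L)

  -- An element is discarded only in favour of a related one, which on `L` is the element itself.
  deduplicateᵇ-⊇ : ∀ {L} → (∀ {x y} → x ∈ L → y ∈ L → T (r x y) → x ≡ y) →
    ∀ {z} → z ∈ L → z ∈ deduplicateᵇ r L
  deduplicateᵇ-⊇ {x ∷ L} h (here refl) = here refl
  deduplicateᵇ-⊇ {x ∷ L} h {z} (there z∈) with T? (r x z)
  ... | yes t = here (sym (h (here refl) (there z∈) t))
  ... | no ¬t = there (∈-filter⁺ (¬? ∘ λ y → T? (r x y))
                  (deduplicateᵇ-⊇ (λ x∈ y∈ → h (there x∈) (there y∈)) z∈) ¬t)

-- Masks and the sublists they select.

masksAbove-length : ∀ {ds μ} → μ ∈ masksAbove ds → length μ ≡ length ds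
masksAbove-length {[]} (here refl) = refl
masksAbove-length {true ∷ ds} μ∈ with _ , ν∈ , refl ← ∈-map⁻ (true ∷_) μ∈ =
  cong suc (masksAbove-length {ds} ν∈)
masksAbove-length {false ∷ ds} μ∈ with ∈-++⁻ (map (true ∷_) (masksAbove ds)) μ∈
... | inj₁ μ∈′ with _ , ν∈ , refl ← ∈-map⁻ (true ∷_) μ∈′  = cong suc (masksAbove-length {ds} ν∈)
... | inj₂ μ∈′ with _ , ν∈ , refl ← ∈-map⁻ (false ∷_) μ∈′ = cong suc (masksAbove-length {ds} ν∈)

masksAbove-unique : ∀ ds → Unique (masksAbove ds)
masksAbove-unique []           = [] ∷ []
masksAbove-unique (true  ∷ ds) = Uniqueₚ.map⁺ Listₚ.∷-injectiveʳ (masksAbove-unique ds)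
masksAbove-unique (false ∷ ds) = Uniqueₚ.++⁺
  (Uniqueₚ.map⁺ Listₚ.∷-injectiveʳ (masksAbove-unique ds))
  (Uniqueₚ.map⁺ Listₚ.∷-injectiveʳ (masksAbove-unique ds))
  disjoint
  where
  disjoint : ∀ {μ} → μ ∈ map (true ∷_) (masksAbove ds) × μ ∈ map (false ∷_) (masksAbove ds) → ⊥
  disjoint (p , q) with ∈-map⁻ (true ∷_) p | ∈-map⁻ (false ∷_) q
  ... | _ , _ , refl | _ , _ , ()

falses≡length∸trues : ∀ μ → falses μ ≡ length μ ∸ trues μ
falses≡length∸trues μ = trans (sym (ℕₚ.m+n∸m≡n (trues μ) (falses μ))) (cong (_∸ trues μ) (total μ))
  where
  total : ∀ μ → trues μ + falses μ ≡ length μ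
  total []          = refl
  total (true  ∷ μ) = cong suc (total μ)
  total (false ∷ μ) = trans (ℕₚ.+-suc (trues μ) (falses μ)) (cong suc (total μ))

trues≤length : ∀ μ → trues μ ≤ length μ
trues≤length []          = z≤n
trues≤length (true  ∷ μ) = s≤s (trues≤length μ)
trues≤length (false ∷ μ) = ℕₚ.m≤n⇒m≤1+n (trues≤length μ)

select : List A → List Bool → List A
select []       μ           = []
select (x ∷ xs) []          = []
select (x ∷ xs) (true  ∷ μ) = x ∷ select xs μ
select (x ∷ xs) (false ∷ μ) = select xs μ

length-select : (xs : List A) (μ : List Bool) → length xs ≡ length μ → length (select xs μ) ≡ trues μ
length-select []       []          eq = refl
length-select (x ∷ xs) (true  ∷ μ) eq = cong suc (length-select xs μ (ℕₚ.suc-injective eq))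
length-select (x ∷ xs) (false ∷ μ) eq = length-select xs μ (ℕₚ.suc-injective eq)

∈-sublists⁻ : {xs ys : List A} → ys ∈ sublists xs →
  ∃ λ μ → length xs ≡ length μ × ys ≡ select xs μ
∈-sublists⁻ {xs = []} (here refl) = [] , refl , refl
∈-sublists⁻ {xs = x ∷ xs} ys∈ with ∈-++⁻ (sublists xs) ys∈
... | inj₁ ys∈′ = let μ , l , e = ∈-sublists⁻ {xs = xs} ys∈′ in false ∷ μ , cong suc l , e
... | inj₂ ys∈′ with zs , zs∈ , refl ← ∈-map⁻ (x ∷_) ys∈′ =
  let μ , l , e = ∈-sublists⁻ {xs = xs} zs∈ in true ∷ μ , cong suc l , cong (x ∷_) e

∈-sublists⁺ : (xs : List A) (μ : List Bool) → length xs ≡ length μ → select xs μ ∈ sublists xs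
∈-sublists⁺ []       []          eq = here refl
∈-sublists⁺ (x ∷ xs) (true  ∷ μ) eq =
  ∈-++⁺ʳ (sublists xs) (∈-map⁺ (x ∷_) (∈-sublists⁺ xs μ (ℕₚ.suc-injective eq)))
∈-sublists⁺ (x ∷ xs) (false ∷ μ) eq = ∈-++⁺ˡ (∈-sublists⁺ xs μ (ℕₚ.suc-injective eq))

-- Block labels of a cut word.

-- A mask has one entry fewer than its word, so it is empty only at the last letter; no letter then
-- receives the default value.
next : ℕ → List Bool → ℕ
next c []      = c
next c (b ∷ μ) = if b then suc c else c

next-≥ : ∀ c μ → c ≤ next c μ
next-≥ c []          = ℕₚ.≤-refl
next-≥ c (true  ∷ μ) = ℕₚ.n≤1+n c
next-≥ c (false ∷ μ) = ℕₚ.≤-refl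

-- A mask records after which letters a word is cut into blocks; label c xs μ tags every letter
-- with the index of its block, counted from c.
label : ℕ → List A → List Bool → List (A × ℕ)
label c []       μ = []
label c (x ∷ xs) μ = (x , c) ∷ label (next c μ) xs (drop 1 μ)

label-map : (f : A → B) → ∀ c xs μ → label c (map f xs) μ ≡ map (map₁ f) (label c xs μ)
label-map f c []       μ = refl
label-map f c (x ∷ xs) μ = cong ((f x , c) ∷_) (label-map f (next c μ) xs (drop 1 μ))

map-proj₁-label : ∀ c (xs : List A) μ → map proj₁ (label c xs μ) ≡ xs
map-proj₁-label c []       μ = refl
map-proj₁-label c (x ∷ xs) μ = cong (x ∷_) (map-proj₁-label (next c μ) xs (drop 1 μ))

label-≥ : ∀ c (xs : List A) μ → All (λ p → c ≤ proj₂ p) (label c xs μ)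
label-≥ c []       μ = []
label-≥ c (x ∷ xs) μ = ℕₚ.≤-refl ∷ All.map (ℕₚ.≤-trans (next-≥ c μ)) (label-≥ (next c μ) xs (drop 1 μ))

label-sorted : ∀ c (xs : List A) μ → AllPairs (λ p q → proj₂ p ≤ proj₂ q) (label c xs μ)
label-sorted c []       μ = []
label-sorted c (x ∷ xs) μ =
  All.tail (label-≥ c (x ∷ xs) μ) ∷ label-sorted (next c μ) xs (drop 1 μ)

label-allPairs : {R : A → A → Set} → ∀ c {xs} μ → AllPairs R xs →
  AllPairs (λ p q → R (proj₁ p) (proj₁ q)) (label c xs μ)
label-allPairs c {xs} μ r = AllPairsₚ.map⁻ (subst (AllPairs _) (sym (map-proj₁-label c xs μ)) r)

label-≤ : ∀ c (xs : List A) μ → length xs ≡ suc (length μ) →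
  All (λ p → proj₂ p ≤ c + trues μ) (label c xs μ)
label-≤ c (x ∷ [])     []          eq = ℕₚ.m≤m+n c 0 ∷ []
label-≤ c (x ∷ y ∷ xs) (true  ∷ μ) eq = ℕₚ.m≤m+n c _ ∷
  subst (λ b → All (λ p → proj₂ p ≤ b) (label (suc c) (y ∷ xs) μ)) (sym (ℕₚ.+-suc c (trues μ)))
    (label-≤ (suc c) (y ∷ xs) μ (ℕₚ.suc-injective eq))
label-≤ c (x ∷ y ∷ xs) (false ∷ μ) eq =
  ℕₚ.m≤m+n c _ ∷ label-≤ c (y ∷ xs) μ (ℕₚ.suc-injective eq)

-- Labels rise by at most one from letter to letter, so no block index is skipped.
label-attains : ∀ c (xs : List A) μ → length xs ≡ suc (length μ) →
  ∀ {b} → c ≤ b → b ≤ c + trues μ → ∃ λ z → (z , b) ∈ label c xs μ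
label-attains c (x ∷ []) [] eq c≤b b≤ =
  x , here (cong (x ,_) (ℕₚ.≤-antisym (ℕₚ.≤-trans b≤ (ℕₚ.≤-reflexive (ℕₚ.+-identityʳ c))) c≤b))
label-attains c (x ∷ y ∷ xs) (true ∷ μ) eq c≤b b≤ with ℕₚ.m≤n⇒m<n∨m≡n c≤b
... | inj₂ refl = x , here refl
... | inj₁ c<b  = let z , z∈ = label-attains (suc c) (y ∷ xs) μ (ℕₚ.suc-injective eq) c<b
                                 (ℕₚ.≤-trans b≤ (ℕₚ.≤-reflexive (ℕₚ.+-suc c (trues μ))))
                  in z , there z∈
label-attains c (x ∷ y ∷ xs) (false ∷ μ) eq c≤b b≤ =
  let z , z∈ = label-attains c (y ∷ xs) μ (ℕₚ.suc-injective eq) c≤b b≤ in z , there z∈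

label-total : ∀ c (xs : List A) μ {x} → x ∈ xs → ∃ λ b → (x , b) ∈ label c xs μ
label-total c xs μ {x} x∈ with ∈-map⁻ proj₁ (subst (x ∈_) (sym (map-proj₁-label c xs μ)) x∈)
... | (_ , b) , p∈ , refl = b , p∈

label-∈ : ∀ c (xs : List A) μ {x b} → (x , b) ∈ label c xs μ → x ∈ xs
label-∈ c xs μ p∈ = subst (_ ∈_) (map-proj₁-label c xs μ) (∈-map⁺ proj₁ p∈)

label-functional : ∀ c {xs : List A} μ → Unique xs →
  ∀ {x a b} → (x , a) ∈ label c xs μ → (x , b) ∈ label c xs μ → a ≡ b
label-functional c μ u p∈ q∈ with allPairs-lookup (label-allPairs c μ u) p∈ q∈
... | inj₁ refl       = refl
... | inj₂ (inj₁ x≢x) = ⊥-elim (x≢x refl)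
... | inj₂ (inj₂ x≢x) = ⊥-elim (x≢x refl)

next-injective : ∀ c b d {μ ν} → next c (b ∷ μ) ≡ next c (d ∷ ν) → b ≡ d
next-injective c true  true  e = refl
next-injective c false false e = refl
next-injective c true  false e = ⊥-elim (ℕₚ.1+n≢n e)
next-injective c false true  e = ⊥-elim (ℕₚ.1+n≢n (sym e))

-- The mask is the sequence of increments of the labels.
label-injective : ∀ c (xs : List A) μ ν → length xs ≡ suc (length μ) → length xs ≡ suc (length ν) →
  label c xs μ ≡ label c xs ν → μ ≡ ν
label-injective c (x ∷ [])     []      []      l l′ eq = refl
label-injective c (x ∷ y ∷ xs) (b ∷ μ) (d ∷ ν) l l′ eq
  with eq′ ← Listₚ.∷-injectiveʳ eq
  with refl ← next-injective c b d {μ} {ν} (cong proj₂ (Listₚ.∷-injectiveˡ eq′)) =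
  cong (b ∷_) (label-injective (next c (b ∷ μ)) (y ∷ xs) μ ν
    (ℕₚ.suc-injective l) (ℕₚ.suc-injective l′) eq′)

-- Weakly increasing labels without gaps rise by 0 or 1 at each step, and these increments form the
-- mask.
label-reconstruct : ∀ c x (w : List (A × ℕ)) →
  AllPairs (λ p q → proj₂ p ≤ proj₂ q) ((x , c) ∷ w) →
  (∀ {y d b} → (y , d) ∈ (x , c) ∷ w → c ≤ b → b ≤ d → ∃ λ z → (z , b) ∈ (x , c) ∷ w) →
  ∃ λ μ → length μ ≡ length w × (x , c) ∷ w ≡ label c (x ∷ map proj₁ w) μ
label-reconstruct c x [] s conv = [] , refl , refl
label-reconstruct c x ((y , d) ∷ w) ((c≤d ∷ _) ∷ s) conv
  with label-reconstruct d y w s conv′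
  where
  conv′ : ∀ {y′ d′ b} → (y′ , d′) ∈ (y , d) ∷ w → d ≤ b → b ≤ d′ → ∃ λ z → (z , b) ∈ (y , d) ∷ w
  conv′ p∈ d≤b b≤d′ with conv (there p∈) (ℕₚ.≤-trans c≤d d≤b) b≤d′
  ... | z , there z∈  = z , z∈
  -- The letter found may be the dropped `x`; then `b` is `c`, hence `d` equals `b` and `y` takes
  -- its place.
  ... | z , here refl = y , here (cong (y ,_) (ℕₚ.≤-antisym c≤d d≤b))
... | μ , l , e with ℕₚ.m≤n⇒m<n∨m≡n c≤d
... | inj₂ refl = false ∷ μ , cong suc l , cong ((x , c) ∷_) e
... | inj₁ c<d with ℕₚ.m≤n⇒m<n∨m≡n c<d
... | inj₂ refl  = true ∷ μ , cong suc l , cong ((x , c) ∷_) e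
-- A jump by two or more would leave `suc c` without a letter: the head has label `c`, and all later
-- labels are at least `d`.
... | inj₁ 1+c<d = ⊥-elim (gap (conv (there (here refl)) (ℕₚ.n≤1+n c) c<d))
  where
  gap : (∃ λ z → (z , suc c) ∈ (x , c) ∷ (y , d) ∷ w) → ⊥
  gap (z , here e)           = ℕₚ.1+n≢n (cong proj₂ e)
  gap (z , there (here e))   = ℕₚ.<⇒≢ 1+c<d (cong proj₂ e)
  gap (z , there (there z∈)) = ℕₚ.<⇒≱ 1+c<d (All.lookup (AllPairs.head s) z∈)

-- Indicator vectors modulo (1,...,1).

_⊆_ : List A → List A → Set
xs ⊆ ys = ∀ {z} → z ∈ xs → z ∈ ys

T-does : {P : Set} (d : Dec P) → T (does d) → P
T-does (yes p) _ = p

does-T : {P : Set} (d : Dec P) → P → T (does d)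
does-T (yes p) _ = _
does-T (no ¬p) p = ¬p p

T-ext : ∀ {a b} → (T a → T b) → (T b → T a) → a ≡ b
T-ext {true}  {true}  f g = refl
T-ext {false} {false} f g = refl
T-ext {true}  {false} f g = ⊥-elim (f _)
T-ext {false} {true}  f g = ⊥-elim (g _)

mem : Fin n → List (Fin n) → Bool
mem j S = any (λ s → s == j) S

mem⁻ : {j : Fin n} (S : List (Fin n)) → T (mem j S) → j ∈ S
mem⁻ {j = j} S t = Any.map (λ {s} s==j → sym (T-does (s Fin.≟ j) s==j)) (Anyₚ.any⁻ (λ s → s == j) S t)

mem⁺ : {j : Fin n} {S : List (Fin n)} → j ∈ S → T (mem j S)
mem⁺ {j = j} j∈ = Anyₚ.any⁺ (λ s → s == j) (Any.map (λ {s} j≡s → does-T (s Fin.≟ j) (sym j≡s)) j∈)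

indicator-cong : {S S′ : List (Fin n)} → S ⊆ S′ → S′ ⊆ S → indicator n S ≡ indicator n S′
indicator-cong {S = S} {S′} f g = Listₚ.map-cong
  (λ j → cong (λ b → if b then + 1 else + 0) (T-ext (mem⁺ ∘ f ∘ mem⁻ S) (mem⁺ ∘ g ∘ mem⁻ S′)))
  (allFin _)

ray-cong : {S S′ T T′ : List (Fin n)} → S ⊆ S′ → S′ ⊆ S → T ⊆ T′ → T′ ⊆ T → ray n S T ≡ ray n S′ T′
ray-cong f g f′ g′ = cong₂ (λ u v → canon u , canon v) (indicator-cong f g) (indicator-cong f′ g′)

-- The position of the last coordinate does not depend on `f`, so one `y` serves for both indicator
-- vectors compared in `canon-injective`.
lastℤ-map : ∀ x (xs : List A) → ∃ λ y → ∀ (f : A → ℤ) → lastℤ (map f (x ∷ xs)) ≡ f y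
lastℤ-map x []       = x , λ f → refl
lastℤ-map x (y ∷ xs) = lastℤ-map y xs

map-≡⇒ : {f g : A → B} {xs : List A} → map f xs ≡ map g xs → ∀ {x} → x ∈ xs → f x ≡ g x
map-≡⇒ eq (here refl) = Listₚ.∷-injectiveˡ eq
map-≡⇒ eq (there x∈)  = map-≡⇒ (Listₚ.∷-injectiveʳ eq) x∈

-- Only the all-ones and the zero vector differ by a multiple of (1,…,1) among indicator vectors.
canon-injective : {p q : A → Bool} {x₀ : A} {xs : List A} →
  let χ = λ (r : A → Bool) (x : A) → if r x then + 1 else + 0 in
  (∃ λ x → x ∈ x₀ ∷ xs × T (p x)) → (∃ λ x → x ∈ x₀ ∷ xs × T (q x)) →
  canon (map (χ p) (x₀ ∷ xs)) ≡ canon (map (χ q) (x₀ ∷ xs)) → ∀ {x} → x ∈ x₀ ∷ xs → p x ≡ q x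
canon-injective {A = A} {p = p} {q} {x₀} {xs} (a , a∈ , pa) (b , b∈ , qb) eq =
  go (p y) (q y) refl refl
  where
  L = x₀ ∷ xs
  χ : Bool → ℤ
  χ c = if c then + 1 else + 0
  y = proj₁ (lastℤ-map x₀ xs)
  canon≡ : ∀ r → canon (map (χ ∘ r) L) ≡ map (λ x → χ (r x) ℤ.- χ (r y)) L
  canon≡ r = trans (sym (Listₚ.map-∘ L))
    (Listₚ.map-cong (λ x → cong (λ z → χ (r x) ℤ.- z) (proj₂ (lastℤ-map x₀ xs) (χ ∘ r))) L)
  diff : ∀ {x} → x ∈ L → χ (p x) ℤ.- χ (p y) ≡ χ (q x) ℤ.- χ (q y)
  diff = map-≡⇒ (trans (sym (canon≡ p)) (trans eq (canon≡ q)))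
  same : ∀ c d e → χ d ℤ.- χ c ≡ χ e ℤ.- χ c → d ≡ e
  same _     true  true  _ = refl
  same _     false false _ = refl
  same true  true  false ()
  same true  false true  ()
  same false true  false ()
  same false false true  ()
  absurd₁ : ∀ d e → T e → χ d ℤ.- + 1 ≡ χ e ℤ.- + 0 → ⊥
  absurd₁ true  true _ ()
  absurd₁ false true _ ()
  absurd₂ : ∀ d e → T d → χ d ℤ.- + 0 ≡ χ e ℤ.- + 1 → ⊥
  absurd₂ true true  _ ()
  absurd₂ true false _ ()
  go : ∀ c d → p y ≡ c → q y ≡ d → ∀ {x} → x ∈ L → p x ≡ q x
  go true  true  e e′ {x} x∈ = same true (p x) (q x)
    (subst (λ c → χ (p x) ℤ.- χ c ≡ χ (q x) ℤ.- + 1) e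
      (subst (λ d → χ (p x) ℤ.- χ (p y) ≡ χ (q x) ℤ.- χ d) e′ (diff x∈)))
  go false false e e′ {x} x∈ = same false (p x) (q x)
    (subst (λ c → χ (p x) ℤ.- χ c ≡ χ (q x) ℤ.- + 0) e
      (subst (λ d → χ (p x) ℤ.- χ (p y) ≡ χ (q x) ℤ.- χ d) e′ (diff x∈)))
  -- Here `p` holds at the last coordinate and `q` does not. At the point `b`, where `q` holds, the
  -- right side is 1 while the left side is at most 0. The next case is the mirror image, at `a`.
  go true  false e e′ _ = ⊥-elim (absurd₁ (p b) (q b) qb
    (subst (λ c → χ (p b) ℤ.- χ c ≡ χ (q b) ℤ.- + 0) e
      (subst (λ d → χ (p b) ℤ.- χ (p y) ≡ χ (q b) ℤ.- χ d) e′ (diff b∈))))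
  go false true  e e′ _ = ⊥-elim (absurd₂ (p a) (q a) pa
    (subst (λ c → χ (p a) ℤ.- χ c ≡ χ (q a) ℤ.- + 1) e
      (subst (λ d → χ (p a) ℤ.- χ (p y) ≡ χ (q a) ℤ.- χ d) e′ (diff a∈))))

canon-indicator-injective : {S S′ : List (Fin n)} {a b : Fin n} → a ∈ S → b ∈ S′ →
  canon (indicator n S) ≡ canon (indicator n S′) → S ⊆ S′
canon-indicator-injective {n = suc n} {S = S} {S′} a∈ b∈ eq {j} j∈ = mem⁻ S′
  (subst T (canon-injective {p = λ j → mem j S} {q = λ j → mem j S′}
             (_ , ∈-allFin _ , mem⁺ a∈) (_ , ∈-allFin _ , mem⁺ b∈) eq (∈-allFin j))
    (mem⁺ j∈))

-- Rays at the cuts of a labelled word.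

-- The two supports of the ray at the cut between blocks `b` and `suc b`.
lower upper : ℕ → List (A × ℕ) → List A
lower b w = map proj₁ (filter (λ p → proj₂ p ≤? b) w)
upper b w = map proj₁ (filter (λ p → b <? proj₂ p) w)

∈-lower⁻ : ∀ {b j} (w : List (A × ℕ)) → j ∈ lower b w → ∃ λ c → (j , c) ∈ w × c ≤ b
∈-lower⁻ {b = b} w j∈ with ∈-map⁻ proj₁ j∈
... | (_ , c) , p∈ , refl = c , ∈-filter⁻ (λ p → proj₂ p ≤? b) {xs = w} p∈

∈-lower⁺ : ∀ {b j c} {w : List (A × ℕ)} → (j , c) ∈ w → c ≤ b → j ∈ lower b w
∈-lower⁺ {b = b} p∈ c≤b = ∈-map⁺ proj₁ (∈-filter⁺ (λ p → proj₂ p ≤? b) p∈ c≤b)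

∈-upper⁻ : ∀ {b j} (w : List (A × ℕ)) → j ∈ upper b w → ∃ λ c → (j , c) ∈ w × b < c
∈-upper⁻ {b = b} w j∈ with ∈-map⁻ proj₁ j∈
... | (_ , c) , p∈ , refl = c , ∈-filter⁻ (λ p → b <? proj₂ p) {xs = w} p∈

∈-upper⁺ : ∀ {b j c} {w : List (A × ℕ)} → (j , c) ∈ w → b < c → j ∈ upper b w
∈-upper⁺ {b = b} p∈ b<c = ∈-map⁺ proj₁ (∈-filter⁺ (λ p → b <? proj₂ p) p∈ b<c)

lower-⊆ : ∀ {b} {w w′ : List (A × ℕ)} → w ⊆ w′ → lower b w ⊆ lower b w′
lower-⊆ {w = w} f j∈ = let _ , p∈ , c≤b = ∈-lower⁻ w j∈ in ∈-lower⁺ (f p∈) c≤b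

upper-⊆ : ∀ {b} {w w′ : List (A × ℕ)} → w ⊆ w′ → upper b w ⊆ upper b w′
upper-⊆ {w = w} f j∈ = let _ , p∈ , b<c = ∈-upper⁻ w j∈ in ∈-upper⁺ (f p∈) b<c

rayAt : List (Fin n × ℕ) → ℕ → Pt
rayAt {n} w b = ray n (lower b w) (upper b w)

-- The start is arbitrary because the induction in `select-generators` resumes in the middle of the
-- numbering of the blocks.
interval : ℕ → ℕ → List ℕ
interval c zero    = []
interval c (suc m) = c ∷ interval (suc c) m

length-interval : ∀ c m → length (interval c m) ≡ m
length-interval c zero    = refl
length-interval c (suc m) = cong suc (length-interval (suc c) m)

∈-interval⁻ : ∀ {c m b} → b ∈ interval c m → c ≤ b × b < c + m
∈-interval⁻ {c} {suc m} (here refl) = ℕₚ.≤-refl , ℕₚ.m<m+n c (s≤s z≤n)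
∈-interval⁻ {c} {suc m} (there b∈) =
  let l , u = ∈-interval⁻ b∈ in ℕₚ.<⇒≤ l , ℕₚ.≤-trans u (ℕₚ.≤-reflexive (sym (ℕₚ.+-suc c m)))

∈-interval⁺ : ∀ {c m b} → c ≤ b → b < c + m → b ∈ interval c m
∈-interval⁺ {c} {zero}  l u = ⊥-elim (ℕₚ.<⇒≱ u (ℕₚ.≤-trans (ℕₚ.≤-reflexive (ℕₚ.+-identityʳ c)) l))
∈-interval⁺ {c} {suc m} l u with ℕₚ.m≤n⇒m<n∨m≡n l
... | inj₂ refl = here refl
... | inj₁ c<b  = there (∈-interval⁺ c<b (ℕₚ.≤-trans u (ℕₚ.≤-reflexive (ℕₚ.+-suc c m))))

interval-sorted : ∀ c m → AllPairs _<_ (interval c m)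
interval-sorted c zero    = []
interval-sorted c (suc m) = All.tabulate (proj₁ ∘ ∈-interval⁻) ∷ interval-sorted (suc c) m

-- The rays of `maxGens` by recursion on the word, with the letters already passed kept in `pre`; a
-- mask can then be consumed in step with them.
generators : List (Fin n) → List (Fin n) → List Pt
generators         pre []          = []
generators         pre (x ∷ [])    = []
generators {n = n} pre (x ∷ y ∷ B) = ray n (pre ++ x ∷ []) (y ∷ B) ∷ generators (pre ++ x ∷ []) (y ∷ B)

length-generators : ∀ (pre B : List (Fin n)) → length (generators pre B) ≡ length B ∸ 1
length-generators pre []          = refl
length-generators pre (x ∷ [])    = refl
length-generators pre (x ∷ y ∷ B) = cong suc (length-generators (pre ++ x ∷ []) (y ∷ B))

applyUpTo-cong : {f g : ℕ → A} → (∀ i → f i ≡ g i) → ∀ m → applyUpTo f m ≡ applyUpTo g m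
applyUpTo-cong h zero    = refl
applyUpTo-cong h (suc m) = cong₂ _∷_ (h 0) (applyUpTo-cong (h ∘ suc) m)

maxGens≡generators : ∀ {B : List (Fin n)} {D} → 2 * n ∸ 2 ≡ D → length B ≡ suc D →
  maxGens n B ≡ generators [] B
maxGens≡generators {n} {B} refl l = trans (Listₚ.map-applyUpTo id _ (2 * n ∸ 2)) (go [] B _ l)
  where
  go : ∀ pre B D → length B ≡ suc D →
    applyUpTo (λ t → ray n (pre ++ take (suc t) B) (drop (suc t) B)) D ≡ generators pre B
  go pre (x ∷ [])    zero    l = refl
  go pre (x ∷ y ∷ B) (suc D) l = cong (_ ∷_) (trans
    (applyUpTo-cong (λ t → cong (λ S → ray n S (drop (suc t) (y ∷ B)))
                              (sym (Listₚ.++-assoc pre (x ∷ []) (take (suc t) (y ∷ B))))) D)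
    (go (pre ++ x ∷ []) (y ∷ B) D (ℕₚ.suc-injective l)))

-- The letters in `pre` have labels at most `c`. If the cut after `x` is kept, all later labels
-- exceed `c`, so the supports at `c` are exactly the prefix and the rest of the word; if it is
-- dropped, `c` stays the current block.
select-generators : ∀ (pre : List (Fin n × ℕ)) c B μ → length B ≡ suc (length μ) →
  All (λ p → proj₂ p ≤ c) pre →
  select (generators (map proj₁ pre) B) μ ≡ map (rayAt (pre ++ label c B μ)) (interval c (trues μ))
select-generators pre c (x ∷ [])    []      l pre≤ = refl
select-generators {n} pre c (x ∷ y ∷ B) (d ∷ μ) l pre≤ = step d
  where
  pre′ = pre ++ (x , c) ∷ []
  pre′≤ : All (λ p → proj₂ p ≤ c) pre′
  pre′≤ = Allₚ.++⁺ pre≤ (ℕₚ.≤-refl ∷ [])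
  tail≡ : ∀ d → select (generators (map proj₁ pre ++ x ∷ []) (y ∷ B)) μ ≡
    map (rayAt (pre ++ label c (x ∷ y ∷ B) (d ∷ μ))) (interval (next c (d ∷ μ)) (trues μ))
  tail≡ d = begin
    select (generators (map proj₁ pre ++ x ∷ []) (y ∷ B)) μ
      ≡⟨ cong (λ S → select (generators S (y ∷ B)) μ) (sym (Listₚ.map-++ proj₁ pre ((x , c) ∷ []))) ⟩
    select (generators (map proj₁ pre′) (y ∷ B)) μ
      ≡⟨ select-generators pre′ (next c (d ∷ μ)) (y ∷ B) μ (ℕₚ.suc-injective l)
           (All.map (λ q → ℕₚ.≤-trans q (next-≥ c (d ∷ μ))) pre′≤) ⟩
    map (rayAt (pre′ ++ label (next c (d ∷ μ)) (y ∷ B) μ)) (interval (next c (d ∷ μ)) (trues μ))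
      ≡⟨ cong (λ w → map (rayAt w) (interval (next c (d ∷ μ)) (trues μ)))
           (Listₚ.++-assoc pre ((x , c) ∷ []) _) ⟩
    map (rayAt (pre ++ label c (x ∷ y ∷ B) (d ∷ μ))) (interval (next c (d ∷ μ)) (trues μ)) ∎
    where open ≡-Reasoning
  rest = label (suc c) (y ∷ B) μ
  rest> = label-≥ (suc c) (y ∷ B) μ
  word≡ : pre′ ++ rest ≡ pre ++ label c (x ∷ y ∷ B) (true ∷ μ)
  word≡ = Listₚ.++-assoc pre ((x , c) ∷ []) rest
  lower≡ : lower c (pre′ ++ rest) ≡ map proj₁ pre ++ x ∷ []
  lower≡ = begin
    lower c (pre′ ++ rest)
      ≡⟨ cong (map proj₁) (Listₚ.filter-++ (λ p → proj₂ p ≤? c) pre′ rest) ⟩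
    map proj₁ (filter (λ p → proj₂ p ≤? c) pre′ ++ filter (λ p → proj₂ p ≤? c) rest)
      ≡⟨ cong₂ (λ u v → map proj₁ (u ++ v)) (Listₚ.filter-all (λ p → proj₂ p ≤? c) pre′≤)
           (Listₚ.filter-none (λ p → proj₂ p ≤? c) (All.map ℕₚ.<⇒≱ rest>)) ⟩
    map proj₁ (pre′ ++ [])
      ≡⟨ cong (map proj₁) (Listₚ.++-identityʳ pre′) ⟩
    map proj₁ pre′
      ≡⟨ Listₚ.map-++ proj₁ pre ((x , c) ∷ []) ⟩
    map proj₁ pre ++ x ∷ [] ∎
    where open ≡-Reasoning
  upper≡ : upper c (pre′ ++ rest) ≡ y ∷ B
  upper≡ = begin
    upper c (pre′ ++ rest)
      ≡⟨ cong (map proj₁) (Listₚ.filter-++ (λ p → c <? proj₂ p) pre′ rest) ⟩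
    map proj₁ (filter (λ p → c <? proj₂ p) pre′ ++ filter (λ p → c <? proj₂ p) rest)
      ≡⟨ cong₂ (λ u v → map proj₁ (u ++ v))
           (Listₚ.filter-none (λ p → c <? proj₂ p) (All.map ℕₚ.≤⇒≯ pre′≤))
           (Listₚ.filter-all (λ p → c <? proj₂ p) rest>) ⟩
    map proj₁ rest
      ≡⟨ map-proj₁-label (suc c) (y ∷ B) μ ⟩
    y ∷ B ∎
    where open ≡-Reasoning
  step : ∀ d → select (generators (map proj₁ pre) (x ∷ y ∷ B)) (d ∷ μ) ≡
    map (rayAt (pre ++ label c (x ∷ y ∷ B) (d ∷ μ))) (interval c (trues (d ∷ μ)))
  step true  = cong₂ _∷_
    (trans (cong₂ (ray n) (sym lower≡) (sym upper≡)) (cong (λ w → rayAt w c) word≡))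
    (tail≡ true)
  step false = tail≡ false

-- Recovering the block indices from a cone, and the order of its rays.

faceOf : List (Fin n × ℕ) → ℕ → List Pt
faceOf w m = map (rayAt w) (interval 0 m)

-- The supports depend only on which pairs occur, so rearranging letters inside a block does not
-- change the cone.
faceOf-cong : ∀ {w w′ : List (Fin n × ℕ)} {m} → w ⊆ w′ → w′ ⊆ w → faceOf w m ≡ faceOf w′ m
faceOf-cong {m = m} f g = Listₚ.map-cong
  (λ b → ray-cong (lower-⊆ f) (lower-⊆ g) (upper-⊆ f) (upper-⊆ g)) (interval 0 m)

-- `P j` and `Q j` are the first and last block containing `j`. The singly occurring element is not
-- mentioned, so that words with different `k` can be compared through `P` and `Q` alone.
record Blocks (w : List (Fin n × ℕ)) (m : ℕ) (P Q : Fin n → ℕ) : Set where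
  field
    P≤Q     : ∀ j → P j ≤ Q j
    first∈  : ∀ j → (j , P j) ∈ w
    last∈   : ∀ j → (j , Q j) ∈ w
    only    : ∀ {j c} → (j , c) ∈ w → c ≡ P j ⊎ c ≡ Q j
    bounded : ∀ {j c} → (j , c) ∈ w → c ≤ m
    attains : ∀ {c} → c ≤ m → ∃ λ j → (j , c) ∈ w

  lower⁻ : ∀ {b j} → j ∈ lower b w → P j ≤ b
  lower⁻ j∈ with ∈-lower⁻ w j∈
  ... | c , p∈ , c≤b with only p∈
  ... | inj₁ refl = c≤b
  ... | inj₂ refl = ℕₚ.≤-trans (P≤Q _) c≤b

  lower⁺ : ∀ {b j} → P j ≤ b → j ∈ lower b w
  lower⁺ = ∈-lower⁺ (first∈ _)

  upper⁻ : ∀ {b j} → j ∈ upper b w → b < Q j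
  upper⁻ j∈ with ∈-upper⁻ w j∈
  ... | c , p∈ , b<c with only p∈
  ... | inj₁ refl = ℕₚ.≤-trans b<c (P≤Q _)
  ... | inj₂ refl = b<c

  upper⁺ : ∀ {b j} → b < Q j → j ∈ upper b w
  upper⁺ = ∈-upper⁺ (last∈ _)

  -- Blocks 0 and `m` supply the members that `canon-indicator-injective` asks of the two supports.
  lower-inhabited : ∀ b → ∃ λ j → j ∈ lower b w
  lower-inhabited b = let j , p∈ = attains z≤n in j , ∈-lower⁺ p∈ z≤n

  upper-inhabited : ∀ {b} → b < m → ∃ λ j → j ∈ upper b w
  upper-inhabited b<m = let j , p∈ = attains ℕₚ.≤-refl in j , ∈-upper⁺ p∈ b<m

module _ {w w′ : List (Fin n × ℕ)} {m m′ P Q P′ Q′}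
         (bl : Blocks w m P Q) (bl′ : Blocks w′ m′ P′ Q′) where
  private
    module B  = Blocks bl
    module B′ = Blocks bl′

  rayAt-injective : ∀ {b b′} → b < m → b′ < m′ → rayAt w b ≡ rayAt w′ b′ →
    lower b w ⊆ lower b′ w′ × upper b w ⊆ upper b′ w′
  rayAt-injective {b} {b′} b<m b′<m′ eq =
    canon-indicator-injective (proj₂ (B.lower-inhabited b)) (proj₂ (B′.lower-inhabited b′))
      (cong proj₁ eq) ,
    canon-indicator-injective (proj₂ (B.upper-inhabited b<m)) (proj₂ (B′.upper-inhabited b′<m′))
      (cong proj₂ eq)

module _ {w w′ : List (Fin n × ℕ)} {m m′ P Q P′ Q′}
         (bl : Blocks w m P Q) (bl′ : Blocks w′ m′ P′ Q′) (eq : faceOf w m ≡ faceOf w′ m′) where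
  private
    module B  = Blocks bl
    module B′ = Blocks bl′

  faceOf-length : m ≡ m′
  faceOf-length = begin
    m                    ≡⟨ length-interval 0 m ⟨
    length (interval 0 m) ≡⟨ Listₚ.length-map (rayAt w) (interval 0 m) ⟨
    length (faceOf w m)   ≡⟨ cong length eq ⟩
    length (faceOf w′ m′) ≡⟨ Listₚ.length-map (rayAt w′) (interval 0 m′) ⟩
    length (interval 0 m′) ≡⟨ length-interval 0 m′ ⟩
    m′ ∎
    where open ≡-Reasoning

  rayAt≡ : ∀ {b} → b < m → rayAt w b ≡ rayAt w′ b
  rayAt≡ b<m = map-≡⇒ (trans eq (cong (faceOf w′) (sym faceOf-length))) (∈-interval⁺ z≤n b<m)

  -- If `P j < P′ j`, then `P j` is below the number of cuts, so there is a ray at that cut. Its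
  -- first support contains `j` on the side of `w`, hence also on the side of `w′`, which puts
  -- `P′ j` at most at `P j`.
  faceOf⇒P≤ : ∀ j → P′ j ≤ P j
  faceOf⇒P≤ j with ℕₚ.≤-<-connex (P′ j) (P j)
  ... | inj₁ le = le
  ... | inj₂ gt = B′.lower⁻ (proj₁ (rayAt-injective bl bl′ lt (subst (P j <_) faceOf-length lt) (rayAt≡ lt))
                    (B.lower⁺ ℕₚ.≤-refl))
    where lt = ℕₚ.<-≤-trans gt (subst (P′ j ≤_) (sym faceOf-length) (B′.bounded (B′.first∈ j)))

  -- Dually, at the cut `Q′ j` the second support would contain `j` for `w` but not for `w′`.
  faceOf⇒Q≤ : ∀ j → Q j ≤ Q′ j
  faceOf⇒Q≤ j with ℕₚ.≤-<-connex (Q j) (Q′ j)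
  ... | inj₁ le = le
  ... | inj₂ gt = ⊥-elim (ℕₚ.<-irrefl refl (B′.upper⁻
    (proj₂ (rayAt-injective bl bl′ lt (subst (Q′ j <_) faceOf-length lt) (rayAt≡ lt)) (B.upper⁺ gt))))
    where lt = ℕₚ.<-≤-trans gt (B.bounded (B.last∈ j))

-- Successive rays of a cone have growing first and shrinking second component.
record _◁[_]_ (p : Pt) (n : ℕ) (p′ : Pt) : Set where
  field
    {S S′ U U′} : List (Fin n)
    S-inhabited : ∃ (_∈ S)
    U′-inhabited : ∃ (_∈ U′)
    p≡    : p ≡ ray n S U
    p′≡   : p′ ≡ ray n S′ U′
    S⊆S′  : S ⊆ S′
    U′⊆U  : U′ ⊆ U
    p≢p′  : p ≢ p′

-- The two proofs may represent the same ray by different sets; injectivity on nonempty supports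
-- identifies them. The inclusions then close into a cycle, all are equalities, and `p` would equal
-- `p′`.
◁-asym : ∀ {p p′} → p ◁[ n ] p′ → p′ ◁[ n ] p → ⊥
◁-asym {n} {p} {p′} r r′ = R.p≢p′ (trans R.p≡ (trans
  (ray-cong R.S⊆S′ (R′-S′⊆ ∘ R′.S⊆S′ ∘ S′⊆R′-S) (R′-U⊆ ∘ R′.U′⊆U ∘ U⊆R′-U′) R.U′⊆U)
  (sym R.p′≡)))
  where
  module R  = _◁[_]_ r
  module R′ = _◁[_]_ r′
  ∈S′  = R.S⊆S′ (proj₂ R.S-inhabited)
  ∈U   = R.U′⊆U (proj₂ R.U′-inhabited)
  ∈S′′ = R′.S⊆S′ (proj₂ R′.S-inhabited)
  ∈U″  = R′.U′⊆U (proj₂ R′.U′-inhabited)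
  p≡ : ray n R.S R.U ≡ ray n R′.S′ R′.U′
  p≡ = trans (sym R.p≡) R′.p′≡
  p′≡ : ray n R.S′ R.U′ ≡ ray n R′.S R′.U
  p′≡ = trans (sym R.p′≡) R′.p≡
  S′⊆R′-S : R.S′ ⊆ R′.S
  S′⊆R′-S = canon-indicator-injective ∈S′ (proj₂ R′.S-inhabited) (cong proj₁ p′≡)
  R′-S′⊆ : R′.S′ ⊆ R.S
  R′-S′⊆ = canon-indicator-injective ∈S′′ (proj₂ R.S-inhabited) (cong proj₁ (sym p≡))
  U⊆R′-U′ : R.U ⊆ R′.U′
  U⊆R′-U′ = canon-indicator-injective ∈U (proj₂ R′.U′-inhabited) (cong proj₂ p≡)
  R′-U⊆ : R′.U ⊆ R.U′
  R′-U⊆ = canon-indicator-injective ∈U″ (proj₂ R.U′-inhabited) (cong proj₂ (sym p′≡))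

module _ {w : List (Fin n × ℕ)} {m P Q} (bl : Blocks w m P Q) where
  open Blocks bl

  rayAt-◁ : ∀ {b b′} → b < m → b′ < m → b < b′ → rayAt w b ◁[ n ] rayAt w b′
  rayAt-◁ {b} {b′} b<m b′<m b<b′ = record
    { S-inhabited = lower-inhabited b
    ; U′-inhabited = upper-inhabited b′<m
    ; p≡ = refl
    ; p′≡ = refl
    ; S⊆S′ = λ j∈ → lower⁺ (ℕₚ.≤-trans (lower⁻ j∈) (ℕₚ.<⇒≤ b<b′))
    ; U′⊆U = λ j∈ → upper⁺ (ℕₚ.<-trans b<b′ (upper⁻ j∈))
    ; p≢p′ = λ eq → differ (rayAt-injective bl bl b<m b′<m eq) (rayAt-injective bl bl b′<m b<m (sym eq))
    }
    where
    differ : lower b w ⊆ lower b′ w × upper b w ⊆ upper b′ w →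
             lower b′ w ⊆ lower b w × upper b′ w ⊆ upper b w → ⊥
    -- A letter of block `b′` separates the two rays: if `b′` is its first block, it enters the
    -- first support only after `b`; if `b′` is its last block, it has left the second support at
    -- `b′`.
    differ (_ , U) (L , _) with attains (ℕₚ.<⇒≤ b′<m)
    ... | j , j∈ with only j∈
    ... | inj₁ eq = ℕₚ.<⇒≱ b<b′ (subst (_≤ b) (sym eq) (lower⁻ (L (lower⁺ (ℕₚ.≤-reflexive (sym eq))))))
    ... | inj₂ eq = ℕₚ.<-irrefl eq (upper⁻ (U (upper⁺ (subst (b <_) eq b<b′))))

  faceOf-sorted : AllPairs (_◁[ n ]_) (faceOf w m)
  faceOf-sorted = AllPairsₚ.map⁺ (allPairs-map∈
    (λ b∈ b′∈ → rayAt-◁ (proj₂ (∈-interval⁻ b∈)) (proj₂ (∈-interval⁻ b′∈))) (interval-sorted 0 m))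

sameSet-refl : ∀ xs → T (sameSet xs xs)
sameSet-refl xs = Equivalence.from (T-∧ {all (λ x → any (λ y → does (x ≟Pt y)) xs) xs})
  ( Allₚ.all⁻ (λ x → any (λ y → does (x ≟Pt y)) xs) {xs = xs}
      (All.tabulate λ {x} x∈ → Anyₚ.any⁺ _ (Any.map (does-T (x ≟Pt _)) x∈))
  , Allₚ.all⁻ (λ y → any (λ x → does (x ≟Pt y)) xs) {xs = xs}
      (All.tabulate λ {y} y∈ → Anyₚ.any⁺ _ (Any.map (λ {x} y≡x → does-T (x ≟Pt y) (sym y≡x)) y∈)) )

sameSet⇒⊆ : ∀ xs ys → T (sameSet xs ys) → xs ⊆ ys × ys ⊆ xs
sameSet⇒⊆ xs ys t with Equivalence.to T-∧ t
... | p , q =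
  (λ {x} x∈ → Any.map (λ {y} → T-does (x ≟Pt y)) (Anyₚ.any⁻ _ ys (All.lookup (Allₚ.all⁺ _ xs p) x∈))) ,
  (λ {y} y∈ → Any.map (λ {x} e → sym (T-does (x ≟Pt y) e))
                (Anyₚ.any⁻ _ xs (All.lookup (Allₚ.all⁺ _ ys q) y∈)))

-- This turns the comparison used by `cones` into equality of lists, since the rays of every face
-- are listed in the order `◁`.
sameSet⇒≡ : ∀ {xs ys} → AllPairs (_◁[ n ]_) xs → AllPairs (_◁[ n ]_) ys → T (sameSet xs ys) → xs ≡ ys
sameSet⇒≡ {xs = xs} {ys} s s′ t =
  let f , g = sameSet⇒⊆ xs ys t in sorted∧set⇒≡ ◁-asym s s′ f g

-- Occurrences and marked letters.

occ-here : ∀ (x : Fin n) B → occ x (x ∷ B) ≡ suc (occ x B)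
occ-here x B = cong (λ b → (if b then 1 else 0) + occ x B) (dec-true (x Fin.≟ x) refl)

occ-∷-≤ : ∀ (j x : Fin n) B → occ j B ≤ occ j (x ∷ B)
occ-∷-≤ j x B = ℕₚ.m≤n+m (occ j B) _

∈⇒occ : ∀ {j : Fin n} {B} → j ∈ B → 1 ≤ occ j B
∈⇒occ {j = j} {x ∷ B} (here refl) = ℕₚ.≤-trans (s≤s z≤n) (ℕₚ.≤-reflexive (sym (occ-here x B)))
∈⇒occ {j = j} {x ∷ B} (there j∈)  = ℕₚ.≤-trans (∈⇒occ j∈) (occ-∷-≤ j x B)

occ⇒∈ : ∀ {j : Fin n} {B} → 1 ≤ occ j B → j ∈ B
occ⇒∈ {j = j} {x ∷ B} le with j Fin.≟ x
... | yes refl = here refl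
... | no  j≢x  = there (occ⇒∈ le)

occ-shift : ∀ (j x : Fin n) seen B → occ j (x ∷ seen) + occ j B ≡ occ j seen + occ j (x ∷ B)
occ-shift j x seen B with does (j Fin.≟ x)
... | true  = sym (ℕₚ.+-suc (occ j seen) (occ j B))
... | false = refl

forget : Fin n → Letter n → Fin n
forget k (unb j) = j
forget k (bar j) = j
forget k kk      = k

Valid : Fin n → Letter n → Set
Valid k (unb j) = j ≢ k
Valid k (bar j) = j ≢ k
Valid k kk      = ⊤

-- A view of the nested conditional in `mark`: each outcome comes with the facts about `seen` that
-- produced it.
data Marked (k : Fin n) (seen : List (Fin n)) (x : Fin n) : Letter n → Set where
  single : x ≡ k → Marked k seen x kk
  second : x ≢ k → x ∈ seen → Marked k seen x (bar x)
  first  : x ≢ k → x ∉ seen → Marked k seen x (unb x)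

-- Definitionally the head of `mark k seen (x ∷ xs)`.
markLetter : Fin n → List (Fin n) → Fin n → Letter n
markLetter k seen x = if x == k then kk else (if mem x seen then bar x else unb x)

marked : ∀ k seen (x : Fin n) → Marked k seen x (markLetter k seen x)
marked k seen x with x Fin.≟ k
... | yes x≡k = single x≡k
... | no  x≢k with mem x seen in eq
... | true  = second x≢k (mem⁻ seen (subst T (sym eq) tt))
... | false = first x≢k λ x∈ → subst T eq (mem⁺ x∈)

markLetter-single : ∀ k seen → markLetter {n} k seen k ≡ kk
markLetter-single k seen with markLetter k seen k | marked k seen k
... | _ | single _     = refl
... | _ | second k≢k _ = ⊥-elim (k≢k refl)
... | _ | first k≢k _  = ⊥-elim (k≢k refl)

markLetter-second : ∀ {k j : Fin n} {seen} → j ≢ k → j ∈ seen → markLetter k seen j ≡ bar j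
markLetter-second {k = k} {j} {seen} j≢k j∈ with markLetter k seen j | marked k seen j
... | _ | single j≡k  = ⊥-elim (j≢k j≡k)
... | _ | second _ _  = refl
... | _ | first _ j∉  = ⊥-elim (j∉ j∈)

markLetter-first : ∀ {k j : Fin n} {seen} → j ≢ k → j ∉ seen → markLetter k seen j ≡ unb j
markLetter-first {k = k} {j} {seen} j≢k j∉ with markLetter k seen j | marked k seen j
... | _ | single j≡k  = ⊥-elim (j≢k j≡k)
... | _ | second _ j∈ = ⊥-elim (j∉ j∈)
... | _ | first _ _   = refl

forget-marked : ∀ {k seen} {x : Fin n} {l} → Marked k seen x l → forget k l ≡ x
forget-marked (single refl) = refl
forget-marked (second _ _)  = refl
forget-marked (first _ _)   = refl

forget-mark : ∀ k seen (B : List (Fin n)) → map (forget k) (mark k seen B) ≡ B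
forget-mark k seen []      = refl
forget-mark k seen (x ∷ B) = cong₂ _∷_ (forget-marked (marked k seen x)) (forget-mark k (x ∷ seen) B)

mark-∈ : ∀ {k seen} {B : List (Fin n)} {l} → l ∈ mark k seen B → forget k l ∈ B
mark-∈ {k = k} {seen} {B} l∈ = subst (_ ∈_) (forget-mark k seen B) (∈-map⁺ (forget k) l∈)

marked-valid : ∀ {k seen} {x : Fin n} {l} → Marked k seen x l → Valid k l
marked-valid (single _)     = tt
marked-valid (second x≢k _) = x≢k
marked-valid (first x≢k _)  = x≢k

mark-valid : ∀ k seen (B : List (Fin n)) → All (Valid k) (mark k seen B)
mark-valid k seen []      = []
mark-valid k seen (x ∷ B) = marked-valid (marked k seen x) ∷ mark-valid k (x ∷ seen) B

mark-seen : ∀ {j : Fin n} k seen B → j ∈ seen → All (_≢ unb j) (mark k seen B)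
mark-seen k seen []      j∈ = []
mark-seen k seen (x ∷ B) j∈ = head (marked k seen x) ∷ mark-seen k (x ∷ seen) B (there j∈)
  where
  head : ∀ {l} → Marked k seen x l → l ≢ unb _
  head (first _ x∉) refl = x∉ j∈

-- Once an element has occurred, no letter marks a first occurrence of it.
FirstOnce : Fin n → Letter n → Letter n → Set
FirstOnce k x y = y ≢ unb (forget k x)

mark-firstOnce : ∀ k seen (B : List (Fin n)) → AllPairs (FirstOnce k) (mark k seen B)
mark-firstOnce k seen []      = []
mark-firstOnce k seen (x ∷ B) =
  subst (λ j → All (_≢ unb j) (mark k (x ∷ seen) B)) (sym (forget-marked (marked k seen x)))
    (mark-seen k (x ∷ seen) B (here refl))
  ∷ mark-firstOnce k (x ∷ seen) B

-- The sum of seen and remaining occurrences is invariant along the word. A repeated `kk` would need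
-- two occurrences of `k`, a repeated `bar x` three of `x`, and `unb x` cannot recur once `x` is
-- seen.
mark-unique : ∀ k seen (B : List (Fin n)) → (∀ j → occ j seen + occ j B ≤ 2) →
  occ k seen + occ k B ≤ 1 → Unique (mark k seen B)
mark-unique k seen []      two one = []
mark-unique k seen (x ∷ B) two one =
  All.tabulate (λ {y} y∈ eq → fresh (marked k seen x) (subst (_∈ mark k (x ∷ seen) B) (sym eq) y∈))
  ∷ mark-unique k (x ∷ seen) B
      (λ j → ℕₚ.≤-trans (ℕₚ.≤-reflexive (occ-shift j x seen B)) (two j))
      (ℕₚ.≤-trans (ℕₚ.≤-reflexive (occ-shift k x seen B)) one)
  where
  twice : ∀ s → x ∈ B → s + occ x (x ∷ B) ≤ suc s → ⊥
  twice s x∈ le = ℕₚ.1+n≰n (ℕₚ.≤-trans (ℕₚ.≤-trans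
    (ℕₚ.≤-reflexive (sym (trans (ℕₚ.+-suc s 1) (cong suc (ℕₚ.+-comm s 1)))))
    (ℕₚ.+-monoʳ-≤ s (ℕₚ.≤-trans (s≤s (∈⇒occ x∈)) (ℕₚ.≤-reflexive (sym (occ-here x B)))))) le)
  fresh : ∀ {l} → Marked k seen x l → l ∈ mark k (x ∷ seen) B → ⊥
  fresh (single refl)   l∈ = twice 0 (mark-∈ {seen = x ∷ seen} l∈)
    (ℕₚ.≤-trans (ℕₚ.m≤n+m _ (occ x seen)) one)
  fresh (second _ x∈)   l∈ = twice 1 (mark-∈ {seen = x ∷ seen} l∈)
    (ℕₚ.≤-trans (ℕₚ.+-monoˡ-≤ _ (∈⇒occ x∈)) (two x))
  fresh (first x≢k x∉)  l∈ =
    All.lookup (mark-seen {j = x} k (x ∷ seen) B (here refl)) l∈ refl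

mark-∋kk : ∀ {k : Fin n} seen {B} → k ∈ B → kk ∈ mark k seen B
mark-∋kk {k = k} seen (here refl) = here (sym (markLetter-single k seen))
mark-∋kk         seen (there k∈)  = there (mark-∋kk (_ ∷ seen) k∈)

mark-∋unb : ∀ {k j : Fin n} {seen B} → j ≢ k → j ∉ seen → j ∈ B → unb j ∈ mark k seen B
mark-∋unb j≢k j∉ (here refl) = here (sym (markLetter-first j≢k j∉))
mark-∋unb {j = j} {B = x ∷ B} j≢k j∉ (there j∈) with j Fin.≟ x
... | yes refl = here (sym (markLetter-first j≢k j∉))
... | no  j≢x  = there (mark-∋unb j≢k (λ { (here eq) → j≢x eq ; (there j∈′) → j∉ j∈′ }) j∈)

mark-∋bar : ∀ {k j : Fin n} {seen B} → j ≢ k → j ∈ seen → j ∈ B → bar j ∈ mark k seen B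
mark-∋bar j≢k j∈ (here refl) = here (sym (markLetter-second j≢k j∈))
mark-∋bar j≢k j∈ (there j∈′) = there (mark-∋bar j≢k (there j∈) j∈′)

mark-∋bar₂ : ∀ {k j : Fin n} {seen B} → j ≢ k → 2 ≤ occ j B → bar j ∈ mark k seen B
mark-∋bar₂ {j = j} {B = x ∷ B} j≢k le with j Fin.≟ x
... | yes refl = there (mark-∋bar j≢k (here refl) (occ⇒∈ (ℕₚ.≤-pred le)))
... | no  j≢x  = there (mark-∋bar₂ j≢k le)

-- A sequence of letters is already a marking if every barred letter has its unbarred partner,
-- either in `M` or already passed into `seen`: `FirstOnce` makes the partner come earlier.
mark-forget : ∀ {k : Fin n} {seen M} → All (Valid k) M → AllPairs (FirstOnce k) M →
  (∀ {j} → unb j ∈ M → j ∉ seen) → (∀ {j} → bar j ∈ M → j ∈ seen ⊎ unb j ∈ M) →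
  mark k seen (map (forget k) M) ≡ M
mark-forget {M = []}            []       []       new old = refl
mark-forget {k = k} {seen} {x ∷ M} (v ∷ vs) (r ∷ rs) new old =
  cong₂ _∷_ (head x v r new old) (mark-forget vs rs new′ old′)
  where
  head : ∀ x → Valid k x → All (FirstOnce k x) M → (∀ {j} → unb j ∈ x ∷ M → j ∉ seen) →
    (∀ {j} → bar j ∈ x ∷ M → j ∈ seen ⊎ unb j ∈ x ∷ M) → markLetter k seen (forget k x) ≡ x
  head kk      v r new old = markLetter-single k seen
  head (unb j) v r new old = markLetter-first v (new (here refl))
  head (bar j) v r new old with old (here refl)
  ... | inj₁ j∈         = markLetter-second v j∈
  ... | inj₂ (there u∈) = ⊥-elim (All.lookup r u∈ refl)
  new′ : ∀ {j} → unb j ∈ M → j ∉ forget k x ∷ seen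
  new′ u∈ (here refl) = All.lookup r u∈ refl
  new′ u∈ (there j∈)  = new (there u∈) j∈
  old′ : ∀ {j} → bar j ∈ M → j ∈ forget k x ∷ seen ⊎ unb j ∈ M
  old′ b∈ with old (there b∈)
  ... | inj₁ j∈          = inj₁ (there j∈)
  ... | inj₂ (here refl) = inj₁ (here refl)
  ... | inj₂ (there u∈)  = inj₂ u∈

-- For fixed k the descents of a marked word are its descents with respect to the linear order
--   unbarred j < k increasing,  then barred letters (and k) decreasing,  then unbarred j > k increasing.
-- The three groups are placed in [0,n), [n,2n) and [2n,3n).
module _ {n : ℕ} where

  low : Fin n → Fin n → ℕ
  low k i = if i <F k then toℕ i else n + n + toℕ i

  mid : Fin n → ℕ
  mid i = n + (n ∸ suc (toℕ i))

  -- The single `k` can be ranked as barred throughout: against an unbarred letter, its comparison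
  -- as unbarred `k` has the same outcome as the rule for an unbarred letter next to a barred one,
  -- since that rule also compares with `k`.
  rank : Fin n → Letter n → ℕ
  rank k (unb i) = low k i
  rank k (bar i) = mid i
  rank k kk      = mid k

  <⇒<ᵇ≡true : ∀ {a b} → a < b → (a <ᵇ b) ≡ true
  <⇒<ᵇ≡true a<b = Equivalence.to T-≡ (ℕₚ.<⇒<ᵇ a<b)

  ≮⇒<ᵇ≡false : ∀ {a b} → ¬ a < b → (a <ᵇ b) ≡ false
  ≮⇒<ᵇ≡false {a} {b} a≮b with a <ᵇ b in eq
  ... | true  = ⊥-elim (a≮b (ℕₚ.<ᵇ⇒< a b (subst T (sym eq) tt)))
  ... | false = refl

  low-below : ∀ {k i} → toℕ i < toℕ k → low k i ≡ toℕ i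
  low-below {i = i} i<k = cong (λ b → if b then toℕ i else n + n + toℕ i) (<⇒<ᵇ≡true i<k)

  low-above : ∀ {k i} → ¬ toℕ i < toℕ k → low k i ≡ n + n + toℕ i
  low-above {i = i} i≮k = cong (λ b → if b then toℕ i else n + n + toℕ i) (≮⇒<ᵇ≡false i≮k)

  mid≥ : ∀ i → n ≤ mid i
  mid≥ i = ℕₚ.m≤m+n n _

  mid< : ∀ i → mid i < n + n
  mid< i = ℕₚ.+-monoʳ-< n (ℕₚ.∸-monoʳ-< {o = 0} (s≤s z≤n) (Finₚ.toℕ<n i))

  low-below-< : ∀ {k i} → toℕ i < toℕ k → ∀ j → low k i < mid j
  low-below-< {k} {i} i<k j =
    subst (_< mid j) (sym (low-below i<k)) (ℕₚ.<-≤-trans (Finₚ.toℕ<n i) (mid≥ j))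

  low-above-> : ∀ {k i} → ¬ toℕ i < toℕ k → ∀ j → mid j < low k i
  low-above-> {k} {i} i≮k j =
    subst (mid j <_) (sym (low-above i≮k)) (ℕₚ.<-≤-trans (mid< j) (ℕₚ.m≤m+n (n + n) _))

  low-mono : ∀ {k i j} → toℕ i < toℕ j → low k i < low k j
  low-mono {k} {i} {j} i<j with toℕ i <? toℕ k | toℕ j <? toℕ k
  ... | yes i<k | yes j<k = subst₂ _<_ (sym (low-below i<k)) (sym (low-below j<k)) i<j
  ... | no  i≮k | no  j≮k =
    subst₂ _<_ (sym (low-above i≮k)) (sym (low-above j≮k)) (ℕₚ.+-monoʳ-< (n + n) i<j)
  ... | yes i<k | no  j≮k = ℕₚ.<-trans (low-below-< i<k k) (low-above-> j≮k k)
  ... | no  i≮k | yes j<k = ⊥-elim (i≮k (ℕₚ.<-trans i<j j<k))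

  mid-anti : ∀ {i j} → toℕ i < toℕ j → mid j < mid i
  mid-anti {i} {j} i<j = ℕₚ.+-monoʳ-< n (ℕₚ.∸-monoʳ-< (s≤s i<j) (Finₚ.toℕ<n j))

  rank< : ∀ k l → rank k l < n + n + n
  rank< k (unb i) with toℕ i <? toℕ k
  ... | yes i<k = ℕₚ.<-≤-trans (low-below-< i<k k) (ℕₚ.≤-trans (ℕₚ.<⇒≤ (mid< k)) (ℕₚ.m≤m+n (n + n) n))
  ... | no  i≮k = subst (_< n + n + n) (sym (low-above i≮k)) (ℕₚ.+-monoʳ-< (n + n) (Finₚ.toℕ<n i))
  rank< k (bar i) = ℕₚ.<-≤-trans (mid< i) (ℕₚ.m≤m+n (n + n) n)
  rank< k kk      = ℕₚ.<-≤-trans (mid< k) (ℕₚ.m≤m+n (n + n) n)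

  Comparison : Fin n → Letter n → Letter n → Set
  Comparison k x y = x ≡ y
    ⊎ (isDesc k x y ≡ true × rank k y < rank k x)
    ⊎ (isDesc k x y ≡ false × rank k x < rank k y)

  private
    sides : ∀ {k i : Fin n} → i ≢ k → toℕ i < toℕ k ⊎ toℕ k < toℕ i
    sides {k} {i} i≢k with ℕₚ.<-cmp (toℕ i) (toℕ k)
    ... | tri< i<k _ _ = inj₁ i<k
    ... | tri≈ _ eq _  = ⊥-elim (i≢k (Finₚ.toℕ-injective eq))
    ... | tri> _ _ k<i = inj₂ k<i

    mid-compare : ∀ i j → i ≢ j →
      ((i <F j) ≡ true × mid j < mid i) ⊎ ((i <F j) ≡ false × mid i < mid j)
    mid-compare i j i≢j with sides i≢j
    ... | inj₁ i<j = inj₁ (<⇒<ᵇ≡true i<j , mid-anti i<j)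
    ... | inj₂ j<i = inj₂ (≮⇒<ᵇ≡false (ℕₚ.<-asym j<i) , mid-anti j<i)

    low-mid-compare : ∀ {k} i j → i ≢ k →
      ((k <F i) ≡ true × mid j < low k i) ⊎ ((k <F i) ≡ false × low k i < mid j)
    low-mid-compare i j i≢k with sides i≢k
    ... | inj₁ i<k = inj₂ (≮⇒<ᵇ≡false (ℕₚ.<-asym i<k) , low-below-< i<k j)
    ... | inj₂ k<i = inj₁ (<⇒<ᵇ≡true k<i , low-above-> (ℕₚ.<-asym k<i) j)

    mid-low-compare : ∀ {k} i j → i ≢ k →
      ((i <F k) ≡ true × low k i < mid j) ⊎ ((i <F k) ≡ false × mid j < low k i)
    mid-low-compare i j i≢k with sides i≢k
    ... | inj₁ i<k = inj₁ (<⇒<ᵇ≡true i<k , low-below-< i<k j)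
    ... | inj₂ k<i = inj₂ (≮⇒<ᵇ≡false (ℕₚ.<-asym k<i) , low-above-> (ℕₚ.<-asym k<i) j)

  compare : ∀ k x y → Valid k x → Valid k y → Comparison k x y
  compare k (unb i) (unb j) v v′ with ℕₚ.<-cmp (toℕ i) (toℕ j)
  ... | tri< i<j _ _ = inj₂ (inj₂ (≮⇒<ᵇ≡false (ℕₚ.<-asym i<j) , low-mono {k} i<j))
  ... | tri≈ _ eq _  = inj₁ (cong unb (Finₚ.toℕ-injective eq))
  ... | tri> _ _ j<i = inj₂ (inj₁ (<⇒<ᵇ≡true j<i , low-mono {k} j<i))
  compare k (bar i) (bar j) v v′ with i Fin.≟ j
  ... | yes refl = inj₁ refl
  ... | no  i≢j  = inj₂ (mid-compare i j i≢j)
  compare k (unb i) (bar j) v v′ = inj₂ (low-mid-compare i j v)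
  compare k (bar i) (unb j) v v′ = inj₂ (mid-low-compare j i v′)
  compare k (unb i) kk      v v′ = inj₂ (low-mid-compare i k v)
  compare k kk      (unb j) v v′ = inj₂ (mid-low-compare j k v′)
  compare k (bar i) kk      v v′ = inj₂ (mid-compare i k v)
  compare k kk      (bar j) v v′ = inj₂ (mid-compare k j (v′ ∘ sym))
  compare k kk      kk      v v′ = inj₁ refl

  rank-injective : ∀ {k x y} → Valid k x → Valid k y → rank k x ≡ rank k y → x ≡ y
  rank-injective {k} {x} {y} v v′ eq with compare k x y v v′
  ... | inj₁ x≡y            = x≡y
  ... | inj₂ (inj₁ (_ , lt)) = ⊥-elim (ℕₚ.<⇒≢ lt (sym eq))
  ... | inj₂ (inj₂ (_ , lt)) = ⊥-elim (ℕₚ.<⇒≢ lt eq)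

  -- The lexicographic order by block index and then rank, encoded as one number; the factor
  -- `n + n + n` exceeds every rank.
  key : Fin n → Letter n × ℕ → ℕ
  key k (l , c) = c * (n + n + n) + rank k l

  key-label : ∀ {k p q} → proj₂ p < proj₂ q → key k p < key k q
  key-label {k} {l , c} {l′ , d} c<d = begin-strict
    c * N + rank k l ≡⟨ ℕₚ.+-comm (c * N) _ ⟩
    rank k l + c * N <⟨ ℕₚ.+-monoˡ-< (c * N) (rank< k l) ⟩
    suc c * N        ≤⟨ ℕₚ.*-monoˡ-≤ N c<d ⟩
    d * N            ≤⟨ ℕₚ.m≤m+n (d * N) _ ⟩
    d * N + rank k l′ ∎
    where
    open ℕₚ.≤-Reasoning
    N = n + n + n

  key-≤⇒label-≤ : ∀ {k p q} → key k p ≤ key k q → proj₂ p ≤ proj₂ q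
  key-≤⇒label-≤ {k} {p} {q} le with ℕₚ.≤-<-connex (proj₂ p) (proj₂ q)
  ... | inj₁ c≤d = c≤d
  ... | inj₂ d<c = ⊥-elim (ℕₚ.<⇒≱ (key-label {k} {q} {p} d<c) le)

  key-rank⁺ : ∀ {k l l′ c} → rank k l < rank k l′ → key k (l , c) < key k (l′ , c)
  key-rank⁺ {c = c} = ℕₚ.+-monoʳ-< (c * (n + n + n))

  key-rank⁻ : ∀ {k l l′ c} → key k (l , c) < key k (l′ , c) → rank k l < rank k l′
  key-rank⁻ {c = c} = ℕₚ.+-cancelˡ-< (c * (n + n + n)) _ _

  key-injective : ∀ {k l l′ c d} → Valid k l → Valid k l′ → key k (l , c) ≡ key k (l′ , d) →
    (l , c) ≡ (l′ , d)
  key-injective {k} {l} {l′} {c} {d} v v′ eq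
    with refl ← ℕₚ.≤-antisym (key-≤⇒label-≤ {k} {l , c} {l′ , d} (ℕₚ.≤-reflexive eq))
                             (key-≤⇒label-≤ {k} {l′ , d} {l , c} (ℕₚ.≤-reflexive (sym eq))) =
    cong (_, c) (rank-injective v v′ (ℕₚ.+-cancelˡ-≡ (c * (n + n + n)) _ _ eq))

  KeySorted : Fin n → List (Letter n × ℕ) → Set
  KeySorted k = AllPairs (λ p q → key k p < key k q)

  descentMask : Fin n → List (Letter n) → List Bool
  descentMask k (x ∷ y ∷ M) = isDesc k x y ∷ descentMask k (y ∷ M)
  descentMask k _           = []

  trues-descentMask : ∀ k M → trues (descentMask k M) ≡ descLetters k M
  trues-descentMask k []          = refl
  trues-descentMask k (x ∷ [])    = refl
  trues-descentMask k (x ∷ y ∷ M) = cong (λ z → (if isDesc k x y then 1 else 0) + z) (trues-descentMask k (y ∷ M))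

  length-descentMask : ∀ k M → length (descentMask k M) ≡ length M ∸ 1
  length-descentMask k []          = refl
  length-descentMask k (x ∷ [])    = refl
  length-descentMask k (x ∷ y ∷ M) = cong suc (length-descentMask k (y ∷ M))

-- Cutting at every descent is the same as being sorted by `key`.

∈-masksAbove⁻ : ∀ {b d : Bool} {μ ds} → b ∷ μ ∈ masksAbove (d ∷ ds) →
  (b ≡ true ⊎ (b ≡ false × d ≡ false)) × μ ∈ masksAbove ds
∈-masksAbove⁻ {d = true} μ∈ with ∈-map⁻ (true ∷_) μ∈
... | _ , ν∈ , refl = inj₁ refl , ν∈
∈-masksAbove⁻ {d = false} {ds = ds} μ∈ with ∈-++⁻ (map (true ∷_) (masksAbove ds)) μ∈
... | inj₁ μ∈′ with _ , ν∈ , refl ← ∈-map⁻ (true ∷_) μ∈′ = inj₁ refl , ν∈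
... | inj₂ μ∈′ with _ , ν∈ , refl ← ∈-map⁻ (false ∷_) μ∈′ = inj₂ (refl , refl) , ν∈

true∷-masksAbove : ∀ {μ} d {ds} → μ ∈ masksAbove ds → true ∷ μ ∈ masksAbove (d ∷ ds)
true∷-masksAbove true  μ∈ = ∈-map⁺ (true ∷_) μ∈
true∷-masksAbove false μ∈ = ∈-++⁺ˡ (∈-map⁺ (true ∷_) μ∈)

false∷-masksAbove : ∀ {μ ds} → μ ∈ masksAbove ds → false ∷ μ ∈ masksAbove (false ∷ ds)
false∷-masksAbove {ds = ds} μ∈ = ∈-++⁺ʳ (map (true ∷_) (masksAbove ds)) (∈-map⁺ (false ∷_) μ∈)

-- At a cut the block index rises; where there is no cut the letters ascend, so the rank rises.
masksAbove⇒sorted : ∀ (k : Fin n) c M μ → All (Valid k) M → Unique M →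
  μ ∈ masksAbove (descentMask k M) → Linked (λ p q → key k p < key k q) (label c M μ)
masksAbove⇒sorted k c []       μ v u μ∈ = []
masksAbove⇒sorted k c (x ∷ []) μ v u μ∈ = [-]
masksAbove⇒sorted k c (x ∷ y ∷ M) [] v u μ∈ with () ← masksAbove-length {isDesc k x y ∷ descentMask k (y ∷ M)} μ∈
masksAbove⇒sorted k c (x ∷ y ∷ M) (b ∷ μ) (v ∷ v′ ∷ vs) ((x≢y ∷ _) ∷ u) μ∈
  with ∈-masksAbove⁻ {ds = descentMask k (y ∷ M)} μ∈
... | cut , μ∈′ = head b cut ∷ masksAbove⇒sorted k (next c (b ∷ μ)) (y ∷ M) μ (v′ ∷ vs) u μ∈′
  where
  head : ∀ b → b ≡ true ⊎ (b ≡ false × isDesc k x y ≡ false) →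
    key k (x , c) < key k (y , next c (b ∷ μ))
  head true  _ = key-label {k = k} {x , c} {y , suc c} ℕₚ.≤-refl
  head false (inj₁ ())
  head false (inj₂ (_ , asc)) with compare k x y v v′
  ... | inj₁ x≡y             = ⊥-elim (x≢y x≡y)
  ... | inj₂ (inj₁ (des , _)) with () ← trans (sym des) asc
  ... | inj₂ (inj₂ (_ , lt)) = key-rank⁺ {k = k} {x} {y} {c} lt

-- At an uncut descent the block index would stay and the rank would drop, against sortedness.
sorted⇒masksAbove : ∀ (k : Fin n) c M μ → length M ≡ suc (length μ) → All (Valid k) M →
  KeySorted k (label c M μ) → μ ∈ masksAbove (descentMask k M)
sorted⇒masksAbove k c (x ∷ [])    []      l v s = here refl
sorted⇒masksAbove k c (x ∷ y ∷ M) (b ∷ μ) l (v ∷ v′ ∷ vs) ((lt ∷ _) ∷ s) = step b lt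
  (sorted⇒masksAbove k (next c (b ∷ μ)) (y ∷ M) μ (ℕₚ.suc-injective l) (v′ ∷ vs) s)
  where
  step : ∀ b → key k (x , c) < key k (y , next c (b ∷ μ)) → μ ∈ masksAbove (descentMask k (y ∷ M)) →
    b ∷ μ ∈ masksAbove (isDesc k x y ∷ descentMask k (y ∷ M))
  step true  _  μ∈ = true∷-masksAbove (isDesc k x y) μ∈
  step false lt μ∈ with compare k x y v v′
  ... | inj₁ refl            = ⊥-elim (ℕₚ.<-irrefl refl lt)
  ... | inj₂ (inj₁ (_ , gt)) = ⊥-elim (ℕₚ.<-asym gt (key-rank⁻ {k = k} {x} {y} {c} lt))
  ... | inj₂ (inj₂ (asc , _)) =
    subst (λ d → false ∷ μ ∈ masksAbove (d ∷ descentMask k (y ∷ M))) (sym asc)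
      (false∷-masksAbove {ds = descentMask k (y ∷ M)} μ∈)

-- Bipermutations and their length.

record Biperm (k : Fin n) (B : List (Fin n)) : Set where
  field
    once  : occ k B ≡ 1
    twice : ∀ {j} → j ≢ k → occ j B ≡ 2

isBipermWith⇒Biperm : ∀ {k : Fin n} {B} → T (isBipermWith n k B) → Biperm k B
isBipermWith⇒Biperm {n} {k} {B} t with Equivalence.to (T-∧ {occ k B ≡ᵇ 1}) t
... | p , q = record
  { once  = ℕₚ.≡ᵇ⇒≡ _ _ p
  ; twice = λ {j} j≢k → ℕₚ.≡ᵇ⇒≡ _ _ (drop-k j j≢k (All.lookup (Allₚ.all⁺ _ (allFin n) q) (∈-allFin j)))
  }
  where
  drop-k : ∀ j → j ≢ k → T ((j == k) ∨ (occ j B ≡ᵇ 2)) → T (occ j B ≡ᵇ 2)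
  drop-k j j≢k t with j Fin.≟ k
  ... | yes j≡k = ⊥-elim (j≢k j≡k)
  ... | no  _   = t

Biperm⇒isBipermWith : ∀ {k : Fin n} {B} → Biperm k B → T (isBipermWith n k B)
Biperm⇒isBipermWith {n} {k} {B} b = Equivalence.from (T-∧ {occ k B ≡ᵇ 1})
  ( ℕₚ.≡⇒≡ᵇ _ _ once
  , Allₚ.all⁻ (λ j → (j == k) ∨ (occ j B ≡ᵇ 2)) {xs = allFin n} (All.tabulate λ {j} _ → add-k j) )
  where
  open Biperm b
  add-k : ∀ j → T ((j == k) ∨ (occ j B ≡ᵇ 2))
  add-k j with j Fin.≟ k
  ... | yes _   = tt
  ... | no  j≢k = ℕₚ.≡⇒≡ᵇ _ _ (twice j≢k)

Biperm-functional : ∀ {k k′ : Fin n} {B} → Biperm k B → Biperm k′ B → k ≡ k′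
Biperm-functional {k = k} {k′} b b′ with k Fin.≟ k′
... | yes k≡k′ = k≡k′
... | no  k≢k′ with () ← trans (sym (Biperm.once b)) (Biperm.twice b′ k≢k′)

bool-== : ∀ (j : Fin n) → bool (j == j) ≡ + 1
bool-== j = cong bool (dec-true (j Fin.≟ j) refl)

bool-≢ : ∀ {i j : Fin n} → i ≢ j → bool (i == j) ≡ + 0
bool-≢ {i = i} {j} i≢j = cong bool (dec-false (i Fin.≟ j) i≢j)

Σℤ-allFin-== : ∀ (k : Fin n) → Σℤ (λ j → bool (j == k)) (allFin n) ≡ + 1
Σℤ-allFin-== {n} k =
  trans (Σℤ-single (Uniqueₚ.allFin⁺ n) (∈-allFin k) λ _ → bool-≢) (bool-== k)

Σℤ-occ : ∀ (B : List (Fin n)) → Σℤ (λ j → + occ j B) (allFin n) ≡ + length B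
Σℤ-occ {n} []      = Σℤ-0 (allFin n) λ _ → refl
Σℤ-occ {n} (x ∷ B) = trans (Σℤ-+ (λ j → bool (j == x)) (λ j → + occ j B) (allFin n))
  (cong₂ ℤ._+_ (Σℤ-allFin-== x) (Σℤ-occ B))

Σℤ-const-2 : ∀ {A : Set} (xs : List A) → Σℤ (λ _ → + 2) xs ≡ + (length xs + length xs)
Σℤ-const-2 []       = refl
Σℤ-const-2 (x ∷ xs) = trans (cong (λ z → + 2 ℤ.+ z) (Σℤ-const-2 xs))
  (cong (λ m → + suc m) (sym (ℕₚ.+-suc (length xs) (length xs))))

-- With one further copy of `k` every element would occur twice; summing occurrences over all
-- elements gives the length.
Biperm-length : ∀ {k : Fin n} {B} → Biperm k B → suc (length B) ≡ n + n
Biperm-length {n} {k} {B} b = ℤₚ.+-injective (begin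
  + suc (length B)
    ≡⟨ cong₂ ℤ._+_ (Σℤ-allFin-== k) (Σℤ-occ B) ⟨
  Σℤ (λ j → bool (j == k)) (allFin n) ℤ.+ Σℤ (λ j → + occ j B) (allFin n)
    ≡⟨ Σℤ-+ (λ j → bool (j == k)) (λ j → + occ j B) (allFin n) ⟨
  Σℤ (λ j → bool (j == k) ℤ.+ + occ j B) (allFin n)
    ≡⟨ Σℤ-cong (allFin n) (λ {j} _ → two j) ⟩
  Σℤ (λ _ → + 2) (allFin n)
    ≡⟨ Σℤ-const-2 (allFin n) ⟩
  + (length (allFin n) + length (allFin n))
    ≡⟨ cong (λ m → + (m + m)) (Listₚ.length-tabulate {n = n} id) ⟩
  + (n + n) ∎)
  where
  open ≡-Reasoning
  open Biperm b
  two : ∀ j → bool (j == k) ℤ.+ + occ j B ≡ + 2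
  two j with j Fin.≟ k
  ... | yes refl = cong (λ m → + suc m) once
  ... | no  j≢k  = cong +_ (twice j≢k)

-- The blocks of first and second occurrences.

InLayout : Fin n → (P Q : Fin n → ℕ) → Letter n → ℕ → Set
InLayout k P Q (unb j) c = j ≢ k × c ≡ P j
InLayout k P Q (bar j) c = j ≢ k × c ≡ Q j
InLayout k P Q kk      c = c ≡ P k

inLayout-valid : ∀ {k : Fin n} {P Q} l {c} → InLayout k P Q l c → Valid k l
inLayout-valid (unb _) (v , _) = v
inLayout-valid (bar _) (v , _) = v
inLayout-valid kk      _       = tt

-- W places the first occurrence of j in block P j and the second one in block Q j.
record Layout (k : Fin n) (P Q : Fin n → ℕ) (W : List (Letter n × ℕ)) : Set where
  field
    P≤Q      : ∀ j → P j ≤ Q j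
    Pk≡Qk    : P k ≡ Q k
    sound    : ∀ {l c} → (l , c) ∈ W → InLayout k P Q l c
    complete : ∀ l {c} → InLayout k P Q l c → (l , c) ∈ W

  forget-sound : ∀ {j c} → (j , c) ∈ map (map₁ (forget k)) W → c ≡ P j ⊎ c ≡ Q j
  forget-sound p∈ with ∈-map⁻ (map₁ (forget k)) p∈
  ... | (unb j , c) , q∈ , refl = inj₁ (proj₂ (sound q∈))
  ... | (bar j , c) , q∈ , refl = inj₂ (proj₂ (sound q∈))
  ... | (kk    , c) , q∈ , refl = inj₁ (sound q∈)

  forget-complete : ∀ {j c} → c ≡ P j ⊎ c ≡ Q j → (j , c) ∈ map (map₁ (forget k)) W
  forget-complete {j} eq with j Fin.≟ k
  forget-complete (inj₁ eq) | yes refl = ∈-map⁺ (map₁ (forget k)) (complete kk eq)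
  forget-complete (inj₂ eq) | yes refl = ∈-map⁺ (map₁ (forget k)) (complete kk (trans eq (sym Pk≡Qk)))
  forget-complete {j} (inj₁ eq) | no j≢k = ∈-map⁺ (map₁ (forget k)) (complete (unb j) (j≢k , eq))
  forget-complete {j} (inj₂ eq) | no j≢k = ∈-map⁺ (map₁ (forget k)) (complete (bar j) (j≢k , eq))

module _ {k : Fin n} {B : List (Fin n)} (b : Biperm k B) where
  open Biperm b
  private
    M = mark k [] B

    occ≥1 : ∀ {j} → j ≢ k → 1 ≤ occ j B
    occ≥1 j≢k = subst (1 ≤_) (sym (twice j≢k)) (s≤s z≤n)

    occ≤2 : ∀ j → occ j B ≤ 2
    occ≤2 j with j Fin.≟ k
    ... | yes refl = subst (_≤ 2) (sym once) (s≤s z≤n)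
    ... | no  j≢k  = ℕₚ.≤-reflexive (twice j≢k)

  biperm-marks-unique : Unique M
  biperm-marks-unique = mark-unique k [] B occ≤2 (ℕₚ.≤-reflexive once)

  module _ (μ : List Bool) where
    private
      W = label 0 M μ

      firstLetter : ∀ j → ∃ λ c → (j ≡ k × (kk , c) ∈ W) ⊎ (j ≢ k × (unb j , c) ∈ W)
      firstLetter j with j Fin.≟ k
      ... | yes refl = let c , p = label-total 0 M μ (mark-∋kk [] (occ⇒∈ (ℕₚ.≤-reflexive (sym once))))
                       in c , inj₁ (refl , p)
      ... | no  j≢k  = let c , p = label-total 0 M μ (mark-∋unb j≢k (λ ()) (occ⇒∈ (occ≥1 j≢k)))
                       in c , inj₂ (j≢k , p)

      lastLetter : ∀ j → ∃ λ c → (j ≡ k × (kk , c) ∈ W) ⊎ (j ≢ k × (bar j , c) ∈ W)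
      lastLetter j with j Fin.≟ k
      ... | yes refl = let c , p = label-total 0 M μ (mark-∋kk [] (occ⇒∈ (ℕₚ.≤-reflexive (sym once))))
                       in c , inj₁ (refl , p)
      ... | no  j≢k  = let c , p = label-total 0 M μ (mark-∋bar₂ j≢k (ℕₚ.≤-reflexive (sym (twice j≢k))))
                       in c , inj₂ (j≢k , p)

    firstBlock lastBlock : Fin n → ℕ
    firstBlock j = proj₁ (firstLetter j)
    lastBlock  j = proj₁ (lastLetter j)

    private
      functional : ∀ {l c d} → (l , c) ∈ W → (l , d) ∈ W → c ≡ d
      functional = label-functional 0 μ biperm-marks-unique

      unb∈ : ∀ {j} → j ≢ k → (unb j , firstBlock j) ∈ W
      unb∈ {j} j≢k with firstLetter j
      ... | _ , inj₁ (j≡k , _) = ⊥-elim (j≢k j≡k)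
      ... | _ , inj₂ (_ , p)   = p

      bar∈ : ∀ {j} → j ≢ k → (bar j , lastBlock j) ∈ W
      bar∈ {j} j≢k with lastLetter j
      ... | _ , inj₁ (j≡k , _) = ⊥-elim (j≢k j≡k)
      ... | _ , inj₂ (_ , p)   = p

      kk∈ : (kk , firstBlock k) ∈ W
      kk∈ with firstLetter k
      ... | _ , inj₁ (_ , p)   = p
      ... | _ , inj₂ (k≢k , _) = ⊥-elim (k≢k refl)

      kk∈′ : (kk , lastBlock k) ∈ W
      kk∈′ with lastLetter k
      ... | _ , inj₁ (_ , p)   = p
      ... | _ , inj₂ (k≢k , _) = ⊥-elim (k≢k refl)

      first≤last : ∀ j → firstBlock j ≤ lastBlock j
      first≤last j = cases (j Fin.≟ k)
        where
        cases : Dec (j ≡ k) → firstBlock j ≤ lastBlock j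
        cases (yes refl) = ℕₚ.≤-reflexive (functional kk∈ kk∈′)
        cases (no j≢k)
          -- The pair is compared by position: the barred letter cannot come first because of
          -- `FirstOnce`, and labels increase weakly along the word.
          with allPairs-lookup
                 (AllPairs.zip (label-sorted 0 M μ , label-allPairs 0 μ (mark-firstOnce k [] B)))
                 (unb∈ j≢k) (bar∈ j≢k)
        ... | inj₁ ()
        ... | inj₂ (inj₁ (le , _))    = le
        ... | inj₂ (inj₂ (_ , again)) = ⊥-elim (again refl)

      sound′ : ∀ {l c} → (l , c) ∈ W → InLayout k firstBlock lastBlock l c
      sound′ {unb j} p = let v = All.lookup (mark-valid k [] B) (label-∈ 0 M μ p)
                         in v , functional p (unb∈ v)
      sound′ {bar j} p = let v = All.lookup (mark-valid k [] B) (label-∈ 0 M μ p)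
                         in v , functional p (bar∈ v)
      sound′ {kk}    p = functional p kk∈

      complete′ : ∀ l {c} → InLayout k firstBlock lastBlock l c → (l , c) ∈ W
      complete′ (unb j) (v , refl) = unb∈ v
      complete′ (bar j) (v , refl) = bar∈ v
      complete′ kk      refl       = kk∈

    biperm-layout : Layout k firstBlock lastBlock W
    biperm-layout = record
      { P≤Q = first≤last ; Pk≡Qk = functional kk∈ kk∈′ ; sound = sound′ ; complete = complete′ }

    label≡ : label 0 B μ ≡ map (map₁ (forget k)) W
    label≡ = trans (cong (λ B → label 0 B μ) (sym (forget-mark k [] B))) (label-map (forget k) 0 M μ)

    biperm-blocks : length B ≡ suc (length μ) → Blocks (label 0 B μ) (trues μ) firstBlock lastBlock
    biperm-blocks l = record
      { P≤Q     = first≤last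
      ; first∈  = λ j → subst ((j , firstBlock j) ∈_) (sym label≡) (forget-complete (inj₁ refl))
      ; last∈   = λ j → subst ((j , lastBlock j) ∈_) (sym label≡) (forget-complete (inj₂ refl))
      ; only    = λ p → forget-sound (subst (_ ∈_) label≡ p)
      ; bounded = All.lookup (label-≤ 0 B μ l)
      ; attains = label-attains 0 B μ l z≤n
      }
      where open Layout biperm-layout

-- Uniqueness of the canonical presentation.

length-mark : ∀ k seen (B : List (Fin n)) → length (mark k seen B) ≡ length B
length-mark k seen []      = refl
length-mark k seen (x ∷ B) = cong suc (length-mark k (x ∷ seen) B)

Canonical : Fin n → List (Fin n) → List Bool → Set
Canonical k B μ = μ ∈ masksAbove (descentMask k (mark k [] B))

face : List (Fin n) → List Bool → List Pt
face B μ = select (generators [] B) μ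

face≡faceOf : ∀ (B : List (Fin n)) μ → length B ≡ suc (length μ) →
  face B μ ≡ faceOf (label 0 B μ) (trues μ)
face≡faceOf B μ l = select-generators [] 0 B μ l []

canonical-sorted : ∀ {k : Fin n} {B μ} → Biperm k B → Canonical k B μ → KeySorted k (label 0 (mark k [] B) μ)
canonical-sorted {k = k} {B} {μ} b can = Linkedₚ.Linked⇒AllPairs ℕₚ.<-trans
  (masksAbove⇒sorted k 0 (mark k [] B) μ (mark-valid k [] B) (biperm-marks-unique b) can)

-- Above k, the unbarred letter comes after the barred one in the order of the letters.
sorted⇒k-greatest : ∀ {k : Fin n} {P Q W} → Layout k P Q W → KeySorted k W →
  AllPairs (λ p q → FirstOnce k (proj₁ p) (proj₁ q)) W → ∀ {j} → P j ≡ Q j → toℕ j ≤ toℕ k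
sorted⇒k-greatest {n = n} {k} {P} {Q} lay s f {j} P≡Q with ℕₚ.≤-<-connex (toℕ j) (toℕ k)
... | inj₁ j≤k = j≤k
... | inj₂ k<j
  with allPairs-lookup (AllPairs.zip (s , f)) (complete (unb j) (j≢k , refl)) (complete (bar j) (j≢k , P≡Q))
  where
  open Layout lay
  j≢k : j ≢ k
  j≢k refl = ℕₚ.<-irrefl refl k<j
... | inj₁ ()
... | inj₂ (inj₁ (lt , _)) = ⊥-elim
  (ℕₚ.<-asym (low-above-> (ℕₚ.<-asym k<j) j) (key-rank⁻ {k = k} {unb j} {bar j} {P j} lt))
... | inj₂ (inj₂ (_ , again)) = ⊥-elim (again refl)

-- Equal faces have equal `P` and `Q`; these fix `k`, hence the set of labelled letters, and a
-- sorted list is fixed by its set.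
face-injective : ∀ {k k′ : Fin n} {B B′ μ μ′} → Biperm k B → Biperm k′ B′ →
  length B ≡ suc (length μ) → length B′ ≡ suc (length μ′) →
  Canonical k B μ → Canonical k′ B′ μ′ → face B μ ≡ face B′ μ′ → B ≡ B′ × μ ≡ μ′
face-injective {k = k} {k′} {B} {B′} {μ} {μ′} b b′ l l′ can can′ eq = B≡B′ , μ≡μ′
  where
  M  = mark k [] B
  M′ = mark k′ [] B′
  bl  = biperm-blocks b μ l
  bl′ = biperm-blocks b′ μ′ l′
  module L  = Layout (biperm-layout b μ)
  module L′ = Layout (biperm-layout b′ μ′)
  P  = firstBlock b μ
  Q  = lastBlock b μ
  P′ = firstBlock b′ μ′
  Q′ = lastBlock b′ μ′
  eq′ : faceOf (label 0 B μ) (trues μ) ≡ faceOf (label 0 B′ μ′) (trues μ′)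
  eq′ = trans (sym (face≡faceOf B μ l)) (trans eq (face≡faceOf B′ μ′ l′))
  P≡ : ∀ j → P j ≡ P′ j
  P≡ j = ℕₚ.≤-antisym (faceOf⇒P≤ bl′ bl (sym eq′) j) (faceOf⇒P≤ bl bl′ eq′ j)
  Q≡ : ∀ j → Q j ≡ Q′ j
  Q≡ j = ℕₚ.≤-antisym (faceOf⇒Q≤ bl bl′ eq′ j) (faceOf⇒Q≤ bl′ bl (sym eq′) j)
  s  = canonical-sorted b can
  s′ = canonical-sorted b′ can′
  k≡k′ : k ≡ k′
  -- Each of `k` and `k′` has a single block index for the other word as well, so neither can exceed
  -- the other.
  k≡k′ = Finₚ.toℕ-injective (ℕₚ.≤-antisym
    (sorted⇒k-greatest (biperm-layout b′ μ′) s′ (label-allPairs 0 μ′ (mark-firstOnce k′ [] B′))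
      (trans (sym (P≡ k)) (trans L.Pk≡Qk (Q≡ k))))
    (sorted⇒k-greatest (biperm-layout b μ) s (label-allPairs 0 μ (mark-firstOnce k [] B))
      (trans (P≡ k′) (trans L′.Pk≡Qk (sym (Q≡ k′))))))
  to : ∀ l {c} → InLayout k P Q l c → InLayout k′ P′ Q′ l c
  to (unb j) (v , refl) = v ∘ (λ e → trans e (sym k≡k′)) , P≡ j
  to (bar j) (v , refl) = v ∘ (λ e → trans e (sym k≡k′)) , Q≡ j
  to kk      refl       = trans (P≡ k) (cong P′ k≡k′)
  from : ∀ l {c} → InLayout k′ P′ Q′ l c → InLayout k P Q l c
  from (unb j) (v , refl) = v ∘ (λ e → trans e k≡k′) , sym (P≡ j)
  from (bar j) (v , refl) = v ∘ (λ e → trans e k≡k′) , sym (Q≡ j)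
  from kk      refl       = trans (cong P′ (sym k≡k′)) (sym (P≡ k))
  W≡W′ : label 0 M μ ≡ label 0 M′ μ′
  W≡W′ = sorted∧set⇒≡ ℕₚ.<-asym s (subst (λ k → KeySorted k _) (sym k≡k′) s′)
    (λ {p} p∈ → L′.complete (proj₁ p) (to (proj₁ p) (L.sound p∈)))
    (λ {p} p∈ → L.complete (proj₁ p) (from (proj₁ p) (L′.sound p∈)))
  M≡M′ : M ≡ M′
  M≡M′ = trans (sym (map-proj₁-label 0 M μ)) (trans (cong (map proj₁) W≡W′) (map-proj₁-label 0 M′ μ′))
  B≡B′ : B ≡ B′
  B≡B′ = trans (sym (forget-mark k [] B))
    (trans (cong₂ (λ k M → map (forget k) M) k≡k′ M≡M′) (forget-mark k′ [] B′))
  length-M : length M ≡ suc (length μ)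
  length-M = trans (length-mark k [] B) l
  length-M′ : length M ≡ suc (length μ′)
  length-M′ = trans (cong length M≡M′) (trans (length-mark k′ [] B′) l′)
  μ≡μ′ : μ ≡ μ′
  μ≡μ′ = label-injective 0 M μ μ′ length-M length-M′
    (trans W≡W′ (cong (λ M → label 0 M μ′) (sym M≡M′)))

-- Existence of the canonical presentation.

greatest : ∀ {n} {X : Fin n → Set} → Decidable X → ∃ X → ∃ λ k → X k × (∀ {j} → X j → toℕ j ≤ toℕ k)
greatest {suc n} {X} X? (x , Xx) with Finₚ.any? (X? ∘ suc)
... | yes ex = let k , Xk , max = greatest (X? ∘ suc) ex
               in suc k , Xk , λ { {zero} _ → z≤n ; {suc j} Xj → s≤s (max Xj) }
... | no ¬ex = zero , at-zero x Xx , λ { {zero} _ → z≤n ; {suc j} Xj → ⊥-elim (¬ex (j , Xj)) }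
  where
  at-zero : ∀ x → X x → X zero
  at-zero zero    Xx = Xx
  at-zero (suc x) Xx = ⊥-elim (¬ex (x , Xx))

-- The construction in the opposite direction: from block indices and a choice of `k` back to a
-- word, by sorting all labelled letters. The word is a bipermutation for any such data; that its
-- marking gives back the sorted letters depends on the choice of `k`.
module Arrange {n : ℕ} (k : Fin n) (P Q : Fin n → ℕ) where

  cells : Fin n → List (Letter n × ℕ)
  cells j with j Fin.≟ k
  ... | yes _ = (kk , P k) ∷ []
  ... | no  _ = (unb j , P j) ∷ (bar j , Q j) ∷ []

  cells-forget : ∀ {j p} → p ∈ cells j → forget k (proj₁ p) ≡ j
  cells-forget {j} p∈ with j Fin.≟ k
  cells-forget (here refl)         | yes refl = refl
  cells-forget (here refl)         | no _     = refl
  cells-forget (there (here refl)) | no _     = refl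

  cells-sound : ∀ {j l c} → (l , c) ∈ cells j → InLayout k P Q l c
  cells-sound {j} p∈ with j Fin.≟ k
  cells-sound (here refl)         | yes refl = refl
  cells-sound (here refl)         | no j≢k   = j≢k , refl
  cells-sound (there (here refl)) | no j≢k   = j≢k , refl

  cells-complete : ∀ l {c} → InLayout k P Q l c → (l , c) ∈ cells (forget k l)
  cells-complete (unb j) (v , refl) with j Fin.≟ k
  ... | yes j≡k = ⊥-elim (v j≡k)
  ... | no _    = here refl
  cells-complete (bar j) (v , refl) with j Fin.≟ k
  ... | yes j≡k = ⊥-elim (v j≡k)
  ... | no _    = there (here refl)
  cells-complete kk refl with k Fin.≟ k
  ... | yes _  = here refl
  ... | no k≢k = ⊥-elim (k≢k refl)

  cells-unique : ∀ j → Unique (cells j)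
  cells-unique j with j Fin.≟ k
  ... | yes _ = [] ∷ []
  ... | no  _ = ((λ ()) ∷ []) ∷ [] ∷ []

  unsorted : List (Letter n × ℕ)
  unsorted = concatMap cells (allFin n)

  private
    module S = Sort (On.decTotalOrder ℕₚ.≤-decTotalOrder (key k))

  arranged : List (Letter n × ℕ)
  arranged = S.sort unsorted

  arranged-↭ : arranged ↭ unsorted
  arranged-↭ = S.sort-↭ unsorted

  arranged-sound : ∀ {l c} → (l , c) ∈ arranged → InLayout k P Q l c
  arranged-sound p∈ with ∈-concat⁻′ (map cells (allFin n)) (Permₚ.∈-resp-↭ arranged-↭ p∈)
  ... | _ , p∈′ , c∈ with ∈-map⁻ cells c∈
  ... | j , _ , refl = cells-sound p∈′

  arranged-complete : ∀ l {c} → InLayout k P Q l c → (l , c) ∈ arranged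
  arranged-complete l v = Permₚ.∈-resp-↭ (Perm.↭-sym arranged-↭)
    (∈-concat⁺′ (cells-complete l v) (∈-map⁺ cells (∈-allFin (forget k l))))

  arranged-unique : Unique arranged
  arranged-unique = PermSetoidₚ.Unique-resp-↭ (setoid _) (Perm.↭⇒↭ₛ (Perm.↭-sym arranged-↭))
    (concatMap-unique (forget k ∘ proj₁) (Uniqueₚ.allFin⁺ n) (λ _ → cells-unique _) (λ _ → cells-forget))

  -- Sorting yields weak inequalities; they are strict because the cells are distinct and `key` is
  -- injective on valid letters.
  arranged-sorted : KeySorted k arranged
  arranged-sorted = allPairs-map∈
    (λ p∈ q∈ (p≢q , le) → ℕₚ.≤∧≢⇒< le λ eq → p≢q
       (key-injective (inLayout-valid _ (arranged-sound p∈)) (inLayout-valid _ (arranged-sound q∈)) eq))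
    (AllPairs.zip (arranged-unique , Linkedₚ.Linked⇒AllPairs ℕₚ.≤-trans (S.sort-↗ unsorted)))

  word : List (Fin n)
  word = map (forget k) (map proj₁ arranged)

  -- Counting is invariant under the sorting permutation, so it can be done before sorting, where
  -- only the cells of `j` contribute.
  occ-word : ∀ j → + occ j word ≡ Σℤ (λ p → bool (j == forget k (proj₁ p))) (cells j)
  occ-word j = begin
    + occ j word
      ≡⟨ countᵇ≡Σℤ (j ==_) word ⟩
    Σℤ (bool ∘ (j ==_)) word
      ≡⟨ Σℤ-map (bool ∘ (j ==_)) (forget k) (map proj₁ arranged) ⟩
    Σℤ (λ l → bool (j == forget k l)) (map proj₁ arranged)
      ≡⟨ Σℤ-map (λ l → bool (j == forget k l)) proj₁ arranged ⟩
    Σℤ hit arranged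
      ≡⟨ Σℤ-↭ hit arranged-↭ ⟩
    Σℤ hit unsorted
      ≡⟨ Σℤ-concatMap hit cells (allFin n) ⟩
    Σℤ (λ i → Σℤ hit (cells i)) (allFin n)
      ≡⟨ Σℤ-single (Uniqueₚ.allFin⁺ n) (∈-allFin j) (λ {i} _ i≢j → Σℤ-0 (cells i) λ p∈ →
           bool-≢ λ eq → i≢j (trans (sym (cells-forget p∈)) (sym eq))) ⟩
    Σℤ hit (cells j) ∎
    where
    open ≡-Reasoning
    hit : Letter n × ℕ → ℤ
    hit p = bool (j == forget k (proj₁ p))

  word-biperm : Biperm k word
  word-biperm = record
    { once  = ℤₚ.+-injective (trans (occ-word k) at-k)
    ; twice = λ {j} j≢k → ℤₚ.+-injective (trans (occ-word j) (off-k j j≢k))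
    }
    where
    at-k : Σℤ (λ p → bool (k == forget k (proj₁ p))) (cells k) ≡ + 1
    at-k with k Fin.≟ k
    ... | yes _  = cong (ℤ._+ + 0) (bool-== k)
    ... | no k≢k = ⊥-elim (k≢k refl)
    off-k : ∀ j → j ≢ k → Σℤ (λ p → bool (j == forget k (proj₁ p))) (cells j) ≡ + 2
    off-k j j≢k with j Fin.≟ k
    ... | yes j≡k = ⊥-elim (j≢k j≡k)
    ... | no _    = cong₂ (λ a b → a ℤ.+ (b ℤ.+ + 0)) (bool-== j) (bool-== j)

  module _ (P≤Q : ∀ j → P j ≤ Q j) (Pk≡Qk : P k ≡ Q k) (max : ∀ {j} → P j ≡ Q j → toℕ j ≤ toℕ k) where

    arranged-layout : Layout k P Q arranged
    arranged-layout = record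
      { P≤Q = P≤Q ; Pk≡Qk = Pk≡Qk ; sound = arranged-sound ; complete = arranged-complete }

    private
      firstOnce : ∀ {x y c d} → InLayout k P Q x c → InLayout k P Q y d →
        key k (x , c) < key k (y , d) → FirstOnce k x y
      firstOnce {kk}    _          (v , _)    lt refl = v refl
      firstOnce {unb j} (_ , refl) (_ , refl) lt refl = ℕₚ.<-irrefl refl lt
      -- This is where the maximality of `k` enters. If `bar j` precedes `unb j`, then `P j` and
      -- `Q j` coincide, so `j < k`; but then `unb j` has the smaller rank.
      firstOnce {bar j} (v , refl) (_ , refl) lt refl = ℕₚ.<-asym
        (low-below-< (ℕₚ.≤∧≢⇒< (max P≡Q) (v ∘ Finₚ.toℕ-injective)) j)
        (key-rank⁻ {k = k} {bar j} {unb j} {P j} (subst (λ c → key k (bar j , c) < key k (unb j , P j)) (sym P≡Q) lt))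
        where
        P≡Q : P j ≡ Q j
        P≡Q = ℕₚ.≤-antisym (P≤Q j) (key-≤⇒label-≤ {k = k} {bar j , Q j} {unb j , P j} (ℕₚ.<⇒≤ lt))

      letters : List (Letter n)
      letters = map proj₁ arranged

    -- The descents of `word` are thereby those of the sorted letters, so sortedness can be turned
    -- into a mask above the descents.
    word-marks : mark k [] word ≡ letters
    word-marks = mark-forget
      (Allₚ.map⁺ (All.tabulate λ p∈ → inLayout-valid _ (arranged-sound p∈)))
      (AllPairsₚ.map⁺ (allPairs-map∈
        (λ p∈ q∈ lt → firstOnce (arranged-sound p∈) (arranged-sound q∈) lt) arranged-sorted))
      (λ _ ())
      (λ b∈ → inj₂ (unb∈ b∈))
      where
      unb∈ : ∀ {j} → bar j ∈ letters → unb j ∈ letters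
      unb∈ {j} b∈ with ∈-map⁻ proj₁ b∈
      ... | _ , p∈ , refl = ∈-map⁺ proj₁ (arranged-complete (unb j) (proj₁ (arranged-sound p∈) , refl))

-- The first label is 0, because the label 0 occurs and labels increase weakly; this is the starting
-- index of `label 0`.
nonempty-reconstruct : ∀ {A : Set} (W : List (A × ℕ)) → (∃ λ z → (z , 0) ∈ W) →
  AllPairs (λ p q → proj₂ p ≤ proj₂ q) W →
  (∀ {y d b} → (y , d) ∈ W → b ≤ d → ∃ λ z → (z , b) ∈ W) →
  ∃ λ μ → length W ≡ suc (length μ) × W ≡ label 0 (map proj₁ W) μ
nonempty-reconstruct [] (_ , ()) s conv
nonempty-reconstruct ((x , c) ∷ W) (z , z∈) s conv with c≡0 z∈ s
  where
  c≡0 : ∀ {z c} → (z , 0) ∈ (x , c) ∷ W → AllPairs (λ p q → proj₂ p ≤ proj₂ q) ((x , c) ∷ W) → c ≡ 0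
  c≡0 (here refl) _       = refl
  c≡0 (there z∈)  (a ∷ _) = ℕₚ.n≤0⇒n≡0 (All.lookup a z∈)
... | refl = let μ , l , e = label-reconstruct 0 x W s (λ p∈ _ → conv p∈) in μ , cong suc (sym l) , e

-- The pairs of element and block index do not show which element with a single block index is
-- marked `kk`. Passing from `k` to the greatest such element and sorting anew keeps the set of
-- pairs, hence the face.
canonical-form : ∀ {k : Fin n} {B μ} → Biperm k B → length B ≡ suc (length μ) →
  ∃ λ k′ → ∃₂ λ B′ μ′ → Biperm k′ B′ × length B′ ≡ suc (length μ′) × Canonical k′ B′ μ′ × face B μ ≡ face B′ μ′
canonical-form {n} {k} {B} {μ} b l = k′ , word , μ′ , word-biperm , length-word , canonical , faces≡
  where
  P = firstBlock b μ
  Q = lastBlock b μ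
  module L = Layout (biperm-layout b μ)
  module Bl = Blocks (biperm-blocks b μ l)
  top = greatest (λ j → P j ℕ.≟ Q j) (k , L.Pk≡Qk)
  k′ = proj₁ top
  open Arrange k′ P Q
  lay : Layout k′ P Q arranged
  lay = arranged-layout L.P≤Q (proj₁ (proj₂ top)) (proj₂ (proj₂ top))
  module L′ = Layout lay
  marks : mark k′ [] word ≡ map proj₁ arranged
  marks = word-marks L.P≤Q (proj₁ (proj₂ top)) (proj₂ (proj₂ top))
  labels⊆ : label 0 B μ ⊆ map (map₁ (forget k′)) arranged
  labels⊆ p∈ = L′.forget-complete (L.forget-sound (subst (_ ∈_) (label≡ b μ) p∈))
  labels⊇ : map (map₁ (forget k′)) arranged ⊆ label 0 B μ
  labels⊇ p∈ = subst (_ ∈_) (sym (label≡ b μ)) (L.forget-complete (L′.forget-sound p∈))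
  attained : ∀ {c} → c ≤ trues μ → ∃ λ z → (z , c) ∈ arranged
  attained c≤ with ∈-map⁻ (map₁ (forget k′)) (labels⊆ (proj₂ (Bl.attains c≤)))
  ... | (z , d) , p∈ , eq = z , subst (λ c → (z , c) ∈ arranged) (sym (cong proj₂ eq)) p∈
  rebuilt = nonempty-reconstruct arranged (attained z≤n)
    (AllPairs.map (λ {p} {q} lt → key-≤⇒label-≤ {k = k′} {p} {q} (ℕₚ.<⇒≤ lt)) arranged-sorted)
    (λ p∈ b≤d → attained (ℕₚ.≤-trans b≤d (Bl.bounded (labels⊇ (∈-map⁺ (map₁ (forget k′)) p∈)))))
  μ′ = proj₁ rebuilt
  arranged≡ : arranged ≡ label 0 (map proj₁ arranged) μ′
  arranged≡ = proj₂ (proj₂ rebuilt)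
  length-letters : length (map proj₁ arranged) ≡ suc (length μ′)
  length-letters = trans (Listₚ.length-map proj₁ arranged) (proj₁ (proj₂ rebuilt))
  length-word : length word ≡ suc (length μ′)
  length-word = trans (Listₚ.length-map (forget k′) (map proj₁ arranged)) length-letters
  canonical : Canonical k′ word μ′
  canonical = subst (λ M → μ′ ∈ masksAbove (descentMask k′ M)) (sym marks)
    (sorted⇒masksAbove k′ 0 (map proj₁ arranged) μ′ length-letters
      (subst (All (Valid k′)) marks (mark-valid k′ [] word))
      (subst (KeySorted k′) arranged≡ arranged-sorted))
  word≡ : label 0 word μ′ ≡ map (map₁ (forget k′)) arranged
  word≡ = trans (label-map (forget k′) 0 (map proj₁ arranged) μ′)
    (cong (map (map₁ (forget k′))) (sym arranged≡))
  to : label 0 B μ ⊆ label 0 word μ′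
  to p∈ = subst (_ ∈_) (sym word≡) (labels⊆ p∈)
  from : label 0 word μ′ ⊆ label 0 B μ
  from p∈ = labels⊇ (subst (_ ∈_) word≡ p∈)
  trues≡ : trues μ ≡ trues μ′
  -- The number of cuts is the largest block index, which the set of pairs determines.
  trues≡ = ℕₚ.≤-antisym
    (All.lookup (label-≤ 0 word μ′ length-word) (to (proj₂ (label-attains 0 B μ l z≤n ℕₚ.≤-refl))))
    (All.lookup (label-≤ 0 B μ l) (from (proj₂ (label-attains 0 word μ′ length-word z≤n ℕₚ.≤-refl))))
  faces≡ : face B μ ≡ face word μ′
  faces≡ = begin
    face B μ                           ≡⟨ face≡faceOf B μ l ⟩
    faceOf (label 0 B μ) (trues μ)     ≡⟨ faceOf-cong to from ⟩
    faceOf (label 0 word μ′) (trues μ) ≡⟨ cong (faceOf (label 0 word μ′)) trues≡ ⟩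
    faceOf (label 0 word μ′) (trues μ′) ≡⟨ face≡faceOf word μ′ length-word ⟨
    face word μ′ ∎
    where open ≡-Reasoning

-- Enumerations of bipermutations, faces and canonical presentations.

∈-allSeqs⁻ : ∀ m {B : List (Fin n)} → B ∈ allSeqs n m → length B ≡ m
∈-allSeqs⁻ zero    (here refl) = refl
∈-allSeqs⁻ {n} (suc m) B∈ with ∈-concat⁻′ (map (λ xs → map (_∷ xs) (allFin n)) (allSeqs n m)) B∈
... | _ , B∈′ , b∈ with ∈-map⁻ (λ xs → map (_∷ xs) (allFin n)) b∈
... | xs , xs∈ , refl with ∈-map⁻ (_∷ xs) B∈′
... | _ , _ , refl = cong suc (∈-allSeqs⁻ m xs∈)

∈-allSeqs⁺ : ∀ (B : List (Fin n)) → B ∈ allSeqs n (length B)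
∈-allSeqs⁺ []      = here refl
∈-allSeqs⁺ {n} (x ∷ B) = ∈-concat⁺′ (∈-map⁺ (_∷ B) (∈-allFin x))
  (∈-map⁺ (λ xs → map (_∷ xs) (allFin n)) (∈-allSeqs⁺ B))

allSeqs-unique : ∀ n m → Unique (allSeqs n m)
allSeqs-unique n zero    = [] ∷ []
allSeqs-unique n (suc m) = concatMap-unique (drop 1) (allSeqs-unique n m)
  (λ _ → Uniqueₚ.map⁺ Listₚ.∷-injectiveˡ (Uniqueₚ.allFin⁺ n))
  (λ {xs} _ B∈ → cong (drop 1) (proj₂ (proj₂ (∈-map⁻ (_∷ xs) B∈))))

∈-bipermutations⁻ : ∀ {B : List (Fin n)} → B ∈ bipermutations n → ∃ λ k → Biperm k B
∈-bipermutations⁻ {n} {B} B∈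
  with ∈-filter⁻ (λ B → T? (isBiperm n B)) {xs = allSeqs n (2 * n ∸ 1)} B∈
... | _ , t = let k , b = Any.satisfied (Anyₚ.any⁻ (λ k → isBipermWith n k B) (allFin n) t)
              in k , isBipermWith⇒Biperm b

∈-bipermutations⁺ : ∀ {k : Fin n} {B} → Biperm k B → B ∈ bipermutations n
∈-bipermutations⁺ {n} {k} {B} b = ∈-filter⁺ (λ B → T? (isBiperm n B))
  (subst (λ m → B ∈ allSeqs n m) length≡ (∈-allSeqs⁺ B))
  (Anyₚ.any⁺ (λ k → isBipermWith n k B)
    (Any.map (λ { refl → Biperm⇒isBipermWith b }) (∈-allFin k)))
  where
  length≡ : length B ≡ 2 * n ∸ 1
  length≡ = cong (_∸ 1) (trans (Biperm-length b) (cong (λ m → n + m) (sym (ℕₚ.+-identityʳ n))))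

Biperm-length-suc : ∀ {k : Fin n} {B} → Biperm k B → length B ≡ suc (2 * n ∸ 2)
Biperm-length-suc {suc n} {B = B} b = ℕₚ.suc-injective (trans (Biperm-length b)
  (trans (cong suc (ℕₚ.+-suc n n))
    (cong (λ m → suc (suc m)) (trans (cong (λ m → n + m) (sym (ℕₚ.+-identityʳ n)))
      (sym (cong (_∸ 1) (ℕₚ.+-suc n (n + 0))))))))

-- `k` is found by search, so that the mask depends on `B` alone; the default `[]` is reached only
-- if `B` is not a bipermutation.
descentsOf : List (Fin n) → List Bool
descentsOf {n} B =
  foldr (λ k ds → if isBipermWith n k B then descentMask k (mark k [] B) else ds) [] (allFin n)

descentsOf≡ : ∀ {k : Fin n} {B} → Biperm k B → descentsOf B ≡ descentMask k (mark k [] B)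
descentsOf≡ {n} {k} {B} b = go (∈-allFin k)
  where
  go : ∀ {ks} → k ∈ ks →
    foldr (λ k ds → if isBipermWith n k B then descentMask k (mark k [] B) else ds) [] ks
      ≡ descentMask k (mark k [] B)
  go {k′ ∷ ks} k∈ with isBipermWith n k′ B in eq
  ... | true with refl ← Biperm-functional b (isBipermWith⇒Biperm {k = k′} {B} (subst T (sym eq) tt)) = refl
  go {k′ ∷ ks} (there k∈)  | false = go k∈
  go {k′ ∷ ks} (here refl) | false = ⊥-elim (subst T eq (Biperm⇒isBipermWith b))

length-descentsOf : ∀ {k : Fin n} {B} → Biperm k B → length (descentsOf B) ≡ 2 * n ∸ 2
length-descentsOf {n} {k} {B} b = begin
  length (descentsOf B)                    ≡⟨ cong length (descentsOf≡ b) ⟩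
  length (descentMask k (mark k [] B)) ≡⟨ length-descentMask k (mark k [] B) ⟩
  length (mark k [] B) ∸ 1            ≡⟨ cong (_∸ 1) (length-mark k [] B) ⟩
  length B ∸ 1                        ≡⟨ cong (_∸ 1) (Biperm-length-suc b) ⟩
  2 * n ∸ 2 ∎
  where open ≡-Reasoning

bnum≡ : ∀ n i → bnum n i ≡ countᵇ (λ B → trues (descentsOf B) ≡ᵇ i) (bipermutations n)
bnum≡ n i = countᵇ-cong (bipermutations n) λ {B} B∈ → pred≡ B (∈-bipermutations⁻ B∈)
  where
  pred≡ : ∀ B → (∃ λ k → Biperm k B) →
    any (λ k → isBipermWith n k B ∧ (descents k B ≡ᵇ i)) (allFin n) ≡ (trues (descentsOf B) ≡ᵇ i)
  pred≡ B (k , b) = T-ext to from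
    where
    trues≡ : ∀ {k} → Biperm k B → trues (descentsOf B) ≡ descents k B
    trues≡ {k} b = trans (cong trues (descentsOf≡ b)) (trues-descentMask k (mark k [] B))
    to : T (any (λ k → isBipermWith n k B ∧ (descents k B ≡ᵇ i)) (allFin n)) →
         T (trues (descentsOf B) ≡ᵇ i)
    to t with Any.satisfied (Anyₚ.any⁻ (λ k → isBipermWith n k B ∧ (descents k B ≡ᵇ i)) (allFin n) t)
    ... | k′ , t′ with Equivalence.to (T-∧ {isBipermWith n k′ B}) t′
    ... | b′ , d = subst (λ m → T (m ≡ᵇ i)) (sym (trues≡ (isBipermWith⇒Biperm b′))) d
    from : T (trues (descentsOf B) ≡ᵇ i) →
           T (any (λ k → isBipermWith n k B ∧ (descents k B ≡ᵇ i)) (allFin n))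
    from t = Anyₚ.any⁺ (λ k → isBipermWith n k B ∧ (descents k B ≡ᵇ i))
      (Any.map (λ { refl → Equivalence.from (T-∧ {isBipermWith n k B})
                      (Biperm⇒isBipermWith b , subst (λ m → T (m ≡ᵇ i)) (trues≡ b) t) })
        (∈-allFin k))

record IsFace (n : ℕ) (c : List Pt) : Set where
  field
    {k}    : Fin n
    {w}    : List (Fin n)
    {μ}    : List Bool
    biperm : Biperm k w
    mask   : length w ≡ suc (length μ)
    face≡  : c ≡ face w μ

  mask-length : length μ ≡ 2 * n ∸ 2
  mask-length = ℕₚ.suc-injective (trans (sym mask) (Biperm-length-suc biperm))

  face-length : length c ≡ trues μ
  face-length = trans (cong length face≡) (length-select (generators [] w) μ
    (trans (length-generators [] w) (cong (_∸ 1) mask)))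

  sorted : AllPairs (_◁[ n ]_) c
  sorted = subst (AllPairs _) (sym (trans face≡ (face≡faceOf w μ mask)))
    (faceOf-sorted (biperm-blocks biperm μ mask))

faceLists : (n : ℕ) → List (List Pt)
faceLists n = concatMap (λ B → sublists (maxGens n B)) (bipermutations n)

∈-faceLists⁻ : ∀ {c} → c ∈ faceLists n → IsFace n c
∈-faceLists⁻ {n} c∈
  with ∈-concat⁻′ (map (λ B → sublists (maxGens n B)) (bipermutations n)) c∈
... | _ , c∈′ , s∈ with ∈-map⁻ (λ B → sublists (maxGens n B)) s∈
... | B , B∈ , refl with ∈-bipermutations⁻ B∈
... | k , b with ∈-sublists⁻ {xs = maxGens n B} c∈′
... | μ , l , c≡ = record
  { k      = k
  ; w      = B
  ; μ      = μ
  ; biperm = b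
  ; mask   = trans (Biperm-length-suc b) (cong suc (sym (trans (sym l) length-gens)))
  ; face≡  = trans c≡ (cong (λ gs → select gs μ) gens≡)
  }
  where
  gens≡ : maxGens n B ≡ generators [] B
  gens≡ = maxGens≡generators refl (Biperm-length-suc b)
  length-gens : length (maxGens n B) ≡ 2 * n ∸ 2
  length-gens = trans (cong length gens≡)
    (trans (length-generators [] B) (cong (_∸ 1) (Biperm-length-suc b)))

∈-faceLists⁺ : ∀ {c} → IsFace n c → c ∈ faceLists n
∈-faceLists⁺ {n} {c} f = ∈-concat⁺′ c∈ (∈-map⁺ (λ B → sublists (maxGens n B)) (∈-bipermutations⁺ biperm))
  where
  open IsFace f
  gens≡ : maxGens n w ≡ generators [] w
  gens≡ = maxGens≡generators refl (Biperm-length-suc biperm)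
  c∈ : c ∈ sublists (maxGens n w)
  c∈ = subst₂ (λ c gs → c ∈ sublists gs) (sym face≡) (sym gens≡)
    (∈-sublists⁺ (generators [] w) μ (trans (length-generators [] w) (cong (_∸ 1) mask)))

canonicals : (n : ℕ) → List (List (Fin n) × List Bool)
canonicals n = concatMap (λ B → map (B ,_) (masksAbove (descentsOf B))) (bipermutations n)

record IsCanonical (n : ℕ) (r : List (Fin n) × List Bool) : Set where
  field
    {k}       : Fin n
    biperm    : Biperm k (proj₁ r)
    canonical : Canonical k (proj₁ r) (proj₂ r)

  mask-length : length (proj₂ r) ≡ 2 * n ∸ 2
  mask-length = trans (masksAbove-length {descentMask k (mark k [] (proj₁ r))} canonical)
    (trans (cong length (sym (descentsOf≡ biperm))) (length-descentsOf biperm))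

  mask : length (proj₁ r) ≡ suc (length (proj₂ r))
  mask = trans (Biperm-length-suc biperm) (cong suc (sym mask-length))

∈-canonicals⁻ : ∀ {r} → r ∈ canonicals n → IsCanonical n r
∈-canonicals⁻ {n} r∈
  with ∈-concat⁻′ (map (λ B → map (B ,_) (masksAbove (descentsOf B))) (bipermutations n)) r∈
... | _ , r∈′ , s∈ with ∈-map⁻ (λ B → map (B ,_) (masksAbove (descentsOf B))) s∈
... | B , B∈ , refl with ∈-bipermutations⁻ B∈ | ∈-map⁻ (B ,_) r∈′
... | k , b | μ , μ∈ , refl = record
  { k = k ; biperm = b ; canonical = subst (λ ds → μ ∈ masksAbove ds) (descentsOf≡ b) μ∈ }

∈-canonicals⁺ : ∀ {r} → IsCanonical n r → r ∈ canonicals n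
∈-canonicals⁺ {n} {B , μ} c = ∈-concat⁺′
  (∈-map⁺ (B ,_) (subst (λ ds → μ ∈ masksAbove ds) (sym (descentsOf≡ biperm)) canonical))
  (∈-map⁺ (λ B → map (B ,_) (masksAbove (descentsOf B))) (∈-bipermutations⁺ biperm))
  where open IsCanonical c

canonicals-unique : ∀ n → Unique (canonicals n)
canonicals-unique n = concatMap-unique proj₁
  (Uniqueₚ.filter⁺ (λ B → T? (isBiperm n B)) (allSeqs-unique n (2 * n ∸ 1)))
  (λ {B} _ → Uniqueₚ.map⁺ (cong proj₂) (masksAbove-unique (descentsOf B)))
  (λ {B} _ r∈ → cong proj₁ (proj₂ (proj₂ (∈-map⁻ (B ,_) r∈))))

faceOfPair : List (Fin n) × List Bool → List Pt
faceOfPair (B , μ) = face B μ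

faceOfPair-injective : ∀ {r r′} → IsCanonical n r → IsCanonical n r′ → faceOfPair r ≡ faceOfPair r′ → r ≡ r′
faceOfPair-injective c c′ eq =
  let B≡ , μ≡ = face-injective C.biperm C′.biperm C.mask C′.mask C.canonical C′.canonical eq
  in cong₂ _,_ B≡ μ≡
  where
  module C  = IsCanonical c
  module C′ = IsCanonical c′

canonical-isFace : ∀ {r} → IsCanonical n r → IsFace n (faceOfPair r)
canonical-isFace {r = B , μ} c = record
  { w = B ; μ = μ ; biperm = IsCanonical.biperm c ; mask = IsCanonical.mask c ; face≡ = refl }

face-representative : ∀ {c} → IsFace n c → ∃ λ r → IsCanonical n r × c ≡ faceOfPair r
face-representative f =
  let k , B , μ , b , _ , can , eq = canonical-form (IsFace.biperm f) (IsFace.mask f)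
  in (B , μ) , record { k = k ; biperm = b ; canonical = can } , trans (IsFace.face≡ f) eq

-- `canonical-form` gives every cone a canonical pair and `face-injective` gives only one.
-- Deduplication removes literal repetitions and nothing else, because `sameSet` on faces implies
-- equality.
canonicals↭cones : ∀ n → map faceOfPair (canonicals n) ↭ cones n
canonicals↭cones n = unique∧set⇒↭
  (map-unique
    (λ r∈ r′∈ → faceOfPair-injective (∈-canonicals⁻ {n} r∈) (∈-canonicals⁻ {n} r′∈))
    (canonicals-unique n))
  (deduplicateᵇ-unique sameSet-refl (faceLists n))
  to from
  where
  to : map faceOfPair (canonicals n) ⊆ cones n
  to c∈ with ∈-map⁻ faceOfPair c∈
  ... | r , r∈ , refl = deduplicateᵇ-⊇ {L = faceLists n}
    (λ x∈ y∈ → sameSet⇒≡ {n = n} (IsFace.sorted (∈-faceLists⁻ {n} x∈)) (IsFace.sorted (∈-faceLists⁻ {n} y∈)))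
    (∈-faceLists⁺ {n} (canonical-isFace (∈-canonicals⁻ {n} r∈)))
  from : cones n ⊆ map faceOfPair (canonicals n)
  from c∈ =
    let r , can , c≡ = face-representative (∈-faceLists⁻ {n} (deduplicateᵇ-⊆ {L = faceLists n} c∈))
    in subst (_∈ map faceOfPair (canonicals n)) (sym c≡) (∈-map⁺ faceOfPair (∈-canonicals⁺ can))

-- Comparison of the two polynomials.

-- Both sides become the sum of x to the codimension over all cones: the side of `h` by expanding
-- each power of x + 1 over the masks above the descents, the side of `f` by grouping cones by
-- dimension.
theorem4p3 : (n : ℕ) → 2 ≤ n →
    IsHVector (2 * n ∸ 2) (λ i → + fvec n i) (λ i → + bnum n i)
theorem4p3 n _ j = begin
  coeff (sumPow D (λ i → + bnum n i) X+1) j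
    ≡⟨ coeff-sumPow D (λ i → + bnum n i) X+1 j ⟩
  Σℤ (λ i → + bnum n i ℤ.* coeff (pow X+1 (D ∸ i)) j) (upTo (suc D))
    ≡⟨ Σℤ-cong (upTo (suc D)) (λ {i} _ → cong (λ m → + m ℤ.* coeff (pow X+1 (D ∸ i)) j) (bnum≡ n i)) ⟩
  Σℤ (λ i → + countᵇ (λ B → trues (descentsOf B) ≡ᵇ i) bips ℤ.* coeff (pow X+1 (D ∸ i)) j) (upTo (suc D))
    ≡⟨ Σℤ-byValue D (λ i → coeff (pow X+1 (D ∸ i)) j) (trues ∘ descentsOf) bips
         (λ {B} B∈ → ℕₚ.≤-trans (trues≤length (descentsOf B)) (ℕₚ.≤-reflexive (length-ds B∈))) ⟩
  Σℤ (λ B → coeff (pow X+1 (D ∸ trues (descentsOf B))) j) bips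
    -- `D` is the number of adjacent pairs of letters, so the exponent is the number of
    -- non-descents.
    ≡⟨ Σℤ-cong bips (λ {B} B∈ → trans
         (cong (λ e → coeff (pow X+1 e) j)
           (trans (cong (_∸ trues (descentsOf B)) (sym (length-ds B∈)))
             (sym (falses≡length∸trues (descentsOf B)))))
         (sym (trans (Σℤ-map weight (B ,_) (masksAbove (descentsOf B)))
                     (coeff-pow-X+1 (descentsOf B) j)))) ⟩
  Σℤ (λ B → Σℤ weight (map (B ,_) (masksAbove (descentsOf B)))) bips
    ≡⟨ Σℤ-concatMap weight (λ B → map (B ,_) (masksAbove (descentsOf B))) bips ⟨
  Σℤ weight (canonicals n)
    -- The uncut places of the mask count the codimension, since each cut contributes one ray.
    ≡⟨ Σℤ-cong (canonicals n) (λ {r} r∈ → cong (λ e → coeff (pow Xp e) j) (codim r (∈-canonicals⁻ {n} r∈))) ⟩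
  Σℤ (λ r → coeff (pow Xp (D ∸ length (faceOfPair r))) j) (canonicals n)
    ≡⟨ Σℤ-map (λ c → coeff (pow Xp (D ∸ length c)) j) faceOfPair (canonicals n) ⟨
  Σℤ (λ c → coeff (pow Xp (D ∸ length c)) j) (map faceOfPair (canonicals n))
    ≡⟨ Σℤ-↭ (λ c → coeff (pow Xp (D ∸ length c)) j) (canonicals↭cones n) ⟩
  Σℤ (λ c → coeff (pow Xp (D ∸ length c)) j) (cones n)
    ≡⟨ Σℤ-byValue D (λ i → coeff (pow Xp (D ∸ i)) j) length (cones n)
         (λ c∈ → dim≤ (∈-faceLists⁻ {n} (deduplicateᵇ-⊆ {L = faceLists n} c∈))) ⟨
  Σℤ (λ i → + fvec n i ℤ.* coeff (pow Xp (D ∸ i)) j) (upTo (suc D))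
    ≡⟨ coeff-sumPow D (λ i → + fvec n i) Xp j ⟨
  coeff (sumPow D (λ i → + fvec n i) Xp) j ∎
  where
  open ≡-Reasoning
  D = 2 * n ∸ 2
  bips = bipermutations n
  weight : List (Fin n) × List Bool → ℤ
  weight (B , μ) = coeff (pow Xp (falses μ)) j
  length-ds : ∀ {B} → B ∈ bips → length (descentsOf B) ≡ D
  length-ds B∈ = length-descentsOf (proj₂ (∈-bipermutations⁻ B∈))
  codim : ∀ r → IsCanonical n r → falses (proj₂ r) ≡ D ∸ length (faceOfPair r)
  codim (B , μ) c = trans (falses≡length∸trues μ)
    (cong₂ _∸_ (IsCanonical.mask-length c) (sym (length-select (generators [] B) μ
      (trans (length-generators [] B) (cong (_∸ 1) (IsCanonical.mask c))))))
  dim≤ : ∀ {c} → IsFace n c → length c ≤ D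
  dim≤ f = subst₂ _≤_ (sym face-length) mask-length (trues≤length μ)
    where open IsFace f
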